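{- Suppose $f:2^\Omega\to\mathbb{R}_+$ is monotone and submodular. Then for any finite $O\subset\Omega$ and any $A\in\mathbb{R}_+^\Omega$, $$f(O)\le\widehat f(A)+\sum_{v\in O}\widehat f(v|A).$$
   Context: $\Omega$ is a finite ground set. For $A\in\mathbb{R}_+^\Omega$ (identified in the paper with the "valid" subset $\{(u,t):u\in\Omega,\ 0<t\le A_u\}$ of $\Omega\times\mathbb{R}_+$), $\mathsf{R}(A)\subseteq\Omega$ is the random set that includes each $u\in\Omega$ independently with probability $1-e^{ -A_u}$, and $\widehat f(A):=\mathbf{E}[f(\mathsf{R}(A))]$. For $u\in\Omega$, the marginal value is $\widehat f(u|A):=\lim_{t\to0^+}\frac{\widehat f(A\oplus(u,[t]))-\widehat f(A)}{t}$, where $A\oplus(u,[t])$ is the vector obtained from $A$ by increasing coordinate $u$ by $t$. -}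

module Defs where

open import Algebra.Apartness.Bundles using (HeytingField; HeytingCommutativeRing)
open import Algebra.Bundles using (CommutativeRing; Semiring)
import Algebra.Definitions.RawSemiring as RawSemiringDefinitions
import Algebra.Properties.Ring as RingProperties
import Algebra.Properties.Semiring.Mult as SemiringMult
import Algebra.Solver.Ring.NaturalCoefficients.Default as SemiringSolver
open import Data.Bool.Base using (if_then_else_)
open import Data.Empty using (⊥)
open import Data.Fin.Base using (Fin)
open import Data.Fin.Subset using (Subset; inside; outside; _⊆_; _∪_; _∩_)
open import Data.Fin.Subset.Properties using (_∈?_)
open import Data.Nat.Base as ℕ using (ℕ; zero; suc; _!)
import Data.Nat.Properties as ℕₚ
open import Data.Product.Base using (∃-syntax; _×_; _,_; proj₁; proj₂)
open import Data.Sum.Base using (_⊎_; inj₁; inj₂)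
open import Data.Vec.Base using ([]; _∷_)
open import Data.Vec.Functional using (Vector; updateAt)
open import Function.Base using (_∘_)
open import Level using (Level; _⊔_) renaming (suc to lsuc)
open import Relation.Binary.Core using (Rel)
open import Relation.Binary.Definitions using (Cotransitive)
import Relation.Binary.PropositionalEquality.Core as ≡
open import Relation.Binary.Structures using (IsPreorder; IsStrictPartialOrder)
open import Relation.Nullary.Decidable.Core using (does)
open import Relation.Nullary.Negation.Core using (¬_)

-- The field of real numbers: an Archimedean ordered field in which every
-- Cauchy sequence converges.  Classically these axioms determine ℝ up to
-- unique isomorphism.  They are phrased with a cotransitive, rather than
-- decidable, strict order so that they are also those of the constructive
-- Cauchy reals; x ≤ y is the negation of y < x.
record Reals (c ℓ₁ ℓ₂ : Level) : Set (lsuc (c ⊔ ℓ₁ ⊔ ℓ₂)) where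
  infix 4 _<_ _≤_
  field
    heytingField : HeytingField c ℓ₁ ℓ₂

  open HeytingField heytingField public

  field
    _<_                    : Rel Carrier ℓ₂
    <-isStrictPartialOrder : IsStrictPartialOrder _≈_ _<_
    <-cotrans              : Cotransitive _<_
    <⇒#                    : ∀ {x y} → x < y → x # y
    #⇒<⊎>                  : ∀ {x y} → x # y → x < y ⊎ y < x
    +-monoˡ-<              : ∀ z {x y} → x < y → x + z < y + z
    *-pos                  : ∀ {x y} → 0# < x → 0# < y → 0# < x * y

  _≤_ : Rel Carrier ℓ₂
  x ≤ y = ¬ (y < x)

  commutativeRing : CommutativeRing c ℓ₁
  commutativeRing = HeytingCommutativeRing.commutativeRing heytingCommutativeRing

  open CommutativeRing commutativeRing public
    using (ring; semiring; commutativeSemiring)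
  open RawSemiringDefinitions (Semiring.rawSemiring semiring) public
    using (_^_; sum; product) renaming (_×_ to _×ᴿ_)

  fromℕ : ℕ → Carrier
  fromℕ k = k ×ᴿ 1#

  -- |x - y| < ε
  Within : Carrier → Carrier → Carrier → Set ℓ₂
  Within ε x y = (x - y < ε) × (y - x < ε)

  IsCauchy : (ℕ → Carrier) → Set (c ⊔ ℓ₂)
  IsCauchy s = ∀ ε → 0# < ε → ∃[ N ] ∀ i j → N ℕ.≤ i → N ℕ.≤ j → Within ε (s i) (s j)

  ConvergesTo : (ℕ → Carrier) → Carrier → Set (c ⊔ ℓ₂)
  ConvergesTo s l = ∀ ε → 0# < ε → ∃[ N ] ∀ i → N ℕ.≤ i → Within ε (s i) l

  field
    archimedean : ∀ x → ∃[ k ] x < fromℕ k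
    complete    : ∀ s → IsCauchy s → ∃[ l ] ConvergesTo s l

module OrderedField {c ℓ₁ ℓ₂} (ℛ : Reals c ℓ₁ ℓ₂) where
  open Reals ℛ

  open IsStrictPartialOrder <-isStrictPartialOrder public
    using (<-resp-≈; <-respˡ-≈; <-respʳ-≈)
    renaming (irrefl to <-irrefl; trans to <-trans; asym to <-asym)
  open RingProperties ring public
    using (-0#≈0#; -‿involutive; -‿+-comm; -‿distribˡ-*; -‿distribʳ-*)
  private module SR = SemiringSolver commutativeSemiring

  ≤-reflexive : ∀ {x y} → x ≈ y → x ≤ y
  ≤-reflexive x≈y y<x = <-irrefl (sym x≈y) y<x

  ≤-refl : ∀ {x} → x ≤ x
  ≤-refl = ≤-reflexive refl

  ≤-trans : ∀ {x y z} → x ≤ y → y ≤ z → x ≤ z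
  ≤-trans {y = y} x≤y y≤z z<x with <-cotrans z<x y
  ... | inj₁ z<y = y≤z z<y
  ... | inj₂ y<x = x≤y y<x

  <⇒≤ : ∀ {x y} → x < y → x ≤ y
  <⇒≤ = <-asym

  <-≤-trans : ∀ {x y z} → x < y → y ≤ z → x < z
  <-≤-trans {z = z} x<y y≤z with <-cotrans x<y z
  ... | inj₁ x<z = x<z
  ... | inj₂ z<y with () ← y≤z z<y

  ≤-<-trans : ∀ {x y z} → x ≤ y → y < z → x < z
  ≤-<-trans {x = x} x≤y y<z with <-cotrans y<z x
  ... | inj₁ y<x with () ← x≤y y<x
  ... | inj₂ x<z = x<z

  ≤-antisym : ∀ {x y} → x ≤ y → y ≤ x → x ≈ y
  ≤-antisym {x} {y} x≤y y≤x = proj₁ (tight x y) λ x#y → case (#⇒<⊎> x#y)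
    where
    case : x < y ⊎ y < x → ⊥
    case (inj₁ x<y) = y≤x x<y
    case (inj₂ y<x) = x≤y y<x

  ≤-isPreorder : IsPreorder _≈_ _≤_
  ≤-isPreorder = record
    { isEquivalence = isEquivalence
    ; reflexive     = ≤-reflexive
    ; trans         = ≤-trans
    }

  module ≤-Reasoning where
    open import Relation.Binary.Reasoning.Base.Triple
      ≤-isPreorder <-asym <-trans <-resp-≈ <⇒≤ <-≤-trans ≤-<-trans public

  open ≤-Reasoning

  x+y-y≈x : ∀ x y → (x + y) + - y ≈ x
  x+y-y≈x x y = trans (+-assoc x y (- y)) (trans (+-congˡ (-‿inverseʳ y)) (+-identityʳ x))

  x-y+y≈x : ∀ x y → (x + - y) + y ≈ x
  x-y+y≈x x y = trans (+-assoc x (- y) y) (trans (+-congˡ (-‿inverseˡ y)) (+-identityʳ x))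

  +-monoˡ-≤ : ∀ z {x y} → x ≤ y → x + z ≤ y + z
  +-monoˡ-≤ z {x} {y} x≤y lt =
    x≤y (<-respˡ-≈ (x+y-y≈x y z) (<-respʳ-≈ (x+y-y≈x x z) (+-monoˡ-< (- z) lt)))

  +-monoʳ-≤ : ∀ z {x y} → x ≤ y → z + x ≤ z + y
  +-monoʳ-≤ z {x} {y} x≤y = begin
    z + x  ≈⟨ +-comm z x ⟩
    x + z  ≤⟨ +-monoˡ-≤ z x≤y ⟩
    y + z  ≈⟨ +-comm y z ⟩
    z + y  ∎

  +-mono-≤ : ∀ {x y u v} → x ≤ y → u ≤ v → x + u ≤ y + v
  +-mono-≤ {y = y} {u = u} x≤y u≤v = ≤-trans (+-monoˡ-≤ u x≤y) (+-monoʳ-≤ y u≤v)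

  -‿anti-≤ : ∀ {x y} → x ≤ y → - y ≤ - x
  -‿anti-≤ {x} {y} x≤y = begin
    - y              ≈⟨ x+y-y≈x (- y) x ⟨
    - y + x + - x    ≤⟨ +-monoˡ-≤ (- x) (+-monoʳ-≤ (- y) x≤y) ⟩
    - y + y + - x    ≈⟨ +-congʳ (-‿inverseˡ y) ⟩
    0# + - x         ≈⟨ +-identityˡ (- x) ⟩
    - x              ∎

  x≤y⇒0≤y-x : ∀ {x y} → x ≤ y → 0# ≤ y + - x
  x≤y⇒0≤y-x {x} {y} x≤y = begin
    0#       ≈⟨ -‿inverseʳ x ⟨
    x + - x  ≤⟨ +-monoˡ-≤ (- x) x≤y ⟩
    y + - x  ∎

  0≤y-x⇒x≤y : ∀ {x y} → 0# ≤ y + - x → x ≤ y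
  0≤y-x⇒x≤y {x} {y} p = begin
    x              ≈⟨ +-identityˡ x ⟨
    0# + x         ≤⟨ +-monoˡ-≤ x p ⟩
    y + - x + x    ≈⟨ x-y+y≈x y x ⟩
    y              ∎

  x<y⇒0<y-x : ∀ {x y} → x < y → 0# < y + - x
  x<y⇒0<y-x {x} {y} x<y = begin-strict
    0#       ≈⟨ -‿inverseʳ x ⟨
    x + - x  <⟨ +-monoˡ-< (- x) x<y ⟩
    y + - x  ∎

  0<y-x⇒x<y : ∀ {x y} → 0# < y + - x → x < y
  0<y-x⇒x<y {x} {y} p = begin-strict
    x              ≈⟨ +-identityˡ x ⟨
    0# + x         <⟨ +-monoˡ-< x p ⟩
    y + - x + x    ≈⟨ x-y+y≈x y x ⟩
    y              ∎

  *-nonneg : ∀ {x y} → 0# ≤ x → 0# ≤ y → 0# ≤ x * y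
  *-nonneg {x} {y} 0≤x 0≤y xy<0 = ¬0<x (λ 0<x → ¬0<y 0<x)
    where
    ¬0<y : 0# < x → ⊥
    ¬0<y 0<x = <-irrefl (trans (*-congˡ y≈0) (zeroʳ x)) xy<0
      where
      y≈0 : y ≈ 0#
      y≈0 = ≤-antisym (λ 0<y → <-asym xy<0 (*-pos 0<x 0<y)) 0≤y
    ¬0<x : (0# < x → ⊥) → ⊥
    ¬0<x x≤0 = <-irrefl (trans (*-congʳ (≤-antisym x≤0 0≤x)) (zeroˡ y)) xy<0

  *-monoʳ-≤ : ∀ {x y} z → 0# ≤ z → x ≤ y → x * z ≤ y * z
  *-monoʳ-≤ {x} {y} z 0≤z x≤y = 0≤y-x⇒x≤y (begin
    0#                  ≤⟨ *-nonneg (x≤y⇒0≤y-x x≤y) 0≤z ⟩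
    (y + - x) * z       ≈⟨ distribʳ z y (- x) ⟩
    y * z + - x * z     ≈⟨ +-congˡ (-‿distribˡ-* x z) ⟨
    y * z + - (x * z)   ∎)

  *-monoʳ-< : ∀ {x y} z → 0# < z → x < y → x * z < y * z
  *-monoʳ-< {x} {y} z 0<z x<y = 0<y-x⇒x<y (begin-strict
    0#                  <⟨ *-pos (x<y⇒0<y-x x<y) 0<z ⟩
    (y + - x) * z       ≈⟨ distribʳ z y (- x) ⟩
    y * z + - x * z     ≈⟨ +-congˡ (-‿distribˡ-* x z) ⟨
    y * z + - (x * z)   ∎)

  0<1 : 0# < 1#
  0<1 with #⇒<⊎> 1#0
    where open import Algebra.Apartness.Properties.HeytingCommutativeRing heytingCommutativeRing using (1#0)
  ... | inj₂ 0<1 = 0<1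
  ... | inj₁ 1<0 = begin-strict
    0#               <⟨ *-pos 0<-1 0<-1 ⟩
    (- 1#) * (- 1#)  ≈⟨ -‿distribˡ-* 1# (- 1#) ⟨
    - (1# * - 1#)    ≈⟨ -‿cong (*-identityˡ (- 1#)) ⟩
    - (- 1#)         ≈⟨ -‿involutive 1# ⟩
    1#               ∎
    where
    0<-1 : 0# < - 1#
    0<-1 = <-respʳ-≈ (+-identityˡ (- 1#)) (x<y⇒0<y-x 1<0)

  0≤1 : 0# ≤ 1#
  0≤1 = <⇒≤ 0<1

  fromℕ-nonneg : ∀ k → 0# ≤ fromℕ k
  fromℕ-nonneg zero    = ≤-refl
  fromℕ-nonneg (suc k) = begin
    0#            ≈⟨ +-identityˡ 0# ⟨
    0# + 0#       ≤⟨ +-mono-≤ 0≤1 (fromℕ-nonneg k) ⟩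
    1# + fromℕ k  ∎

  fromℕ-pos : ∀ {k} → 0 ℕ.< k → 0# < fromℕ k
  fromℕ-pos {suc k} _ = begin-strict
    0#            <⟨ 0<1 ⟩
    1#            ≈⟨ +-identityʳ 1# ⟨
    1# + 0#       ≤⟨ +-monoʳ-≤ 1# (fromℕ-nonneg k) ⟩
    1# + fromℕ k  ∎

  fromℕ-mono : ∀ {j k} → j ℕ.≤ k → fromℕ j ≤ fromℕ k
  fromℕ-mono {k = k} ℕ.z≤n = fromℕ-nonneg k
  fromℕ-mono (ℕ.s≤s j≤k)   = +-monoʳ-≤ 1# (fromℕ-mono j≤k)

  fromℕ-+ : ∀ j k → fromℕ (j ℕ.+ k) ≈ fromℕ j + fromℕ k
  fromℕ-+ = SemiringMult.×-homo-+ semiring 1#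

  fromℕ-* : ∀ j k → fromℕ (j ℕ.* k) ≈ fromℕ j * fromℕ k
  fromℕ-* = SemiringMult.×1-homo-* semiring

  recip : ∀ x → 0# < x → Carrier
  recip x 0<x = proj₁ (#⇒invertible (#-sym (<⇒# 0<x)))

  recip-inverseʳ : ∀ x (0<x : 0# < x) → x * recip x 0<x ≈ 1#
  recip-inverseʳ x 0<x = trans (*-congʳ (sym (trans (+-congˡ -0#≈0#) (+-identityʳ x))))
    (proj₂ (proj₂ (#⇒invertible (#-sym (<⇒# 0<x)))))

  recip-unique : ∀ x (0<x : 0# < x) y → x * y ≈ 1# → y ≈ recip x 0<x
  recip-unique x 0<x y xy≈1 = begin-equality
    y                        ≈⟨ *-identityʳ y ⟨
    y * 1#                   ≈⟨ *-congˡ (recip-inverseʳ x 0<x) ⟨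
    y * (x * recip x 0<x)    ≈⟨ *-assoc y x _ ⟨
    (y * x) * recip x 0<x    ≈⟨ *-congʳ (trans (*-comm y x) xy≈1) ⟩
    1# * recip x 0<x         ≈⟨ *-identityˡ _ ⟩
    recip x 0<x              ∎

  recip-pos : ∀ x (0<x : 0# < x) → 0# < recip x 0<x
  recip-pos x 0<x with #⇒<⊎> (#-sym r#0)
    where
    open import Algebra.Apartness.Properties.HeytingCommutativeRing heytingCommutativeRing
      using (invertibleʳ⇒#)
    r#0 : recip x 0<x # 0#
    r#0 = invertibleʳ⇒# (x , trans (*-comm _ x)
      (trans (*-congˡ (trans (+-congˡ -0#≈0#) (+-identityʳ _))) (recip-inverseʳ x 0<x)))
  ... | inj₁ 0<r = 0<r
  ... | inj₂ r<0 with () ← <-asym 0<1 (begin-strict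
    1#                 ≈⟨ recip-inverseʳ x 0<x ⟨
    x * recip x 0<x    ≈⟨ *-comm x _ ⟩
    recip x 0<x * x    <⟨ *-monoʳ-< x 0<x r<0 ⟩
    0# * x             ≈⟨ zeroˡ x ⟩
    0#                 ∎)

  recip-nonneg : ∀ x (0<x : 0# < x) → 0# ≤ recip x 0<x
  recip-nonneg x 0<x = <⇒≤ (recip-pos x 0<x)

  -- |z| ≤ y
  _BoundedBy_ : Carrier → Carrier → Set ℓ₂
  z BoundedBy y = (- y ≤ z) × (z ≤ y)

  private
    x+x≤y+y⇒x≤y : ∀ {x y} → x + x ≤ y + y → x ≤ y
    x+x≤y+y⇒x≤y {x} {y} p y<x = p (<-trans (+-monoˡ-< y y<x)
      (<-respˡ-≈ (+-comm y x) (+-monoˡ-< x y<x)))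

    *-upper : ∀ {a b y d} → a BoundedBy b → y BoundedBy d → a * y ≤ b * d
    *-upper {a} {b} {y} {d} (-b≤a , a≤b) (-d≤y , y≤d) = x+x≤y+y⇒x≤y (0≤y-x⇒x≤y (begin
      0#                                                    ≈⟨ +-identityˡ 0# ⟨
      0# + 0#
        ≤⟨ +-mono-≤ (*-nonneg (x≤y⇒0≤y-x a≤b) 0≤d+y) (*-nonneg 0≤b+a (x≤y⇒0≤y-x y≤d)) ⟩
      (b + - a) * (d + y) + (b + a) * (d + - y)
        ≈⟨ SR.solve 6 (λ a a′ b y y′ d →
             ((b SR.:+ a′) SR.:* (d SR.:+ y) SR.:+ (b SR.:+ a) SR.:* (d SR.:+ y′))
             SR.:=
             ((b SR.:* d SR.:+ b SR.:* d) SR.:+ (a′ SR.:* y SR.:+ a SR.:* y′)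
              SR.:+ (b SR.:* (y SR.:+ y′) SR.:+ (a SR.:+ a′) SR.:* d)))
             refl a (- a) b y (- y) d ⟩
      (b * d + b * d) + (- a * y + a * - y) + (b * (y + - y) + (a + - a) * d)
        ≈⟨ +-cong (+-congˡ (+-cong (sym (-‿distribˡ-* a y)) (sym (-‿distribʳ-* a y))))
             (+-cong (trans (*-congˡ (-‿inverseʳ y)) (zeroʳ b)) (trans (*-congʳ (-‿inverseʳ a)) (zeroˡ d))) ⟩
      (b * d + b * d) + (- (a * y) + - (a * y)) + (0# + 0#)
        ≈⟨ trans (+-congˡ (+-identityˡ 0#)) (+-identityʳ _) ⟩
      (b * d + b * d) + (- (a * y) + - (a * y))
        ≈⟨ +-congˡ (-‿+-comm (a * y) (a * y)) ⟩
      (b * d + b * d) + - (a * y + a * y) ∎))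
      where
      0≤b+a : 0# ≤ b + a
      0≤b+a = ≤-trans (x≤y⇒0≤y-x -b≤a) (≤-reflexive (trans (+-congˡ (-‿involutive b)) (+-comm a b)))
      0≤d+y : 0# ≤ d + y
      0≤d+y = ≤-trans (x≤y⇒0≤y-x -d≤y) (≤-reflexive (trans (+-congˡ (-‿involutive d)) (+-comm y d)))

  BoundedBy-neg : ∀ {z y} → z BoundedBy y → (- z) BoundedBy y
  BoundedBy-neg {z} {y} (-y≤z , z≤y) =
    -‿anti-≤ z≤y , ≤-trans (-‿anti-≤ -y≤z) (≤-reflexive (-‿involutive y))

  BoundedBy-* : ∀ {a b y d} → a BoundedBy b → y BoundedBy d → (a * y) BoundedBy (b * d)
  BoundedBy-* {a} {b} {y} {d} p q = lower , *-upper p q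
    where
    lower : - (b * d) ≤ a * y
    lower = begin
      - (b * d)      ≤⟨ -‿anti-≤ (*-upper (BoundedBy-neg p) q) ⟩
      - (- a * y)    ≈⟨ -‿cong (-‿distribˡ-* a y) ⟨
      - - (a * y)    ≈⟨ -‿involutive (a * y) ⟩
      a * y          ∎

  BoundedBy-resp : ∀ {z z′ y y′} → z ≈ z′ → y ≤ y′ → z BoundedBy y → z′ BoundedBy y′
  BoundedBy-resp z≈z′ y≤y′ (-y≤z , z≤y) =
    ≤-trans (-‿anti-≤ y≤y′) (≤-trans -y≤z (≤-reflexive z≈z′)) ,
    ≤-trans (≤-reflexive (sym z≈z′)) (≤-trans z≤y y≤y′)

  archimedean-bound : ∀ z → ∃[ k ] z BoundedBy fromℕ k
  archimedean-bound z with archimedean z | archimedean (- z)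
  ... | i , z<i | j , -z<j = i ℕ.+ j ,
    ≤-trans (-‿anti-≤ (≤-trans (<⇒≤ -z<j) (fromℕ-mono (ℕₚ.m≤n+m j i)))) (≤-reflexive (-‿involutive z)) ,
    ≤-trans (<⇒≤ z<i) (fromℕ-mono (ℕₚ.m≤m+n i j))

module Exponential {c ℓ₁ ℓ₂} (ℛ : Reals c ℓ₁ ℓ₂) where
  open Reals ℛ
  open OrderedField ℛ
  open ≤-Reasoning
  private module SR = SemiringSolver commutativeSemiring

  fromℕ!-pos : ∀ k → 0# < fromℕ (k !)
  fromℕ!-pos k = fromℕ-pos {k !} (ℕₚ.1≤n! k)

  expTerm : Carrier → ℕ → Carrier
  expTerm x k = x ^ k * recip (fromℕ (k !)) (fromℕ!-pos k)

  expSum : Carrier → ℕ → Carrier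
  expSum x zero    = 0#
  expSum x (suc k) = expSum x k + expTerm x k

  module SeriesBounds where
    inv : ℕ → Carrier
    inv k = recip (fromℕ (suc k)) (fromℕ-pos {suc k} (ℕ.s≤s ℕ.z≤n))

    inv-inverse : ∀ k → fromℕ (suc k) * inv k ≈ 1#
    inv-inverse k = recip-inverseʳ _ _

    inv-nonneg : ∀ k → 0# ≤ inv k
    inv-nonneg k = recip-nonneg _ _

    expTerm-suc : ∀ x k → expTerm x k * (x * inv k) ≈ expTerm x (suc k)
    expTerm-suc x k = begin-equality
      (x ^ k * r) * (x * inv k)
        ≈⟨ SR.solve 4 (λ p r x i → (p SR.:* r) SR.:* (x SR.:* i) SR.:= (x SR.:* p) SR.:* (r SR.:* i))
             refl (x ^ k) r x (inv k) ⟩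
      (x * x ^ k) * (r * inv k)
        ≈⟨ *-congˡ (recip-unique _ _ (r * inv k) eq) ⟩
      expTerm x (suc k) ∎
      where
      r = recip (fromℕ (k !)) (fromℕ!-pos k)
      eq : fromℕ (suc k !) * (r * inv k) ≈ 1#
      eq = begin-equality
        fromℕ (suc k !) * (r * inv k)
          ≈⟨ *-congʳ (fromℕ-* (suc k) (k !)) ⟩
        (fromℕ (suc k) * fromℕ (k !)) * (r * inv k)
          ≈⟨ SR.solve 4 (λ s f r i → (s SR.:* f) SR.:* (r SR.:* i) SR.:= (f SR.:* r) SR.:* (s SR.:* i))
               refl (fromℕ (suc k)) (fromℕ (k !)) r (inv k) ⟩
        (fromℕ (k !) * r) * (fromℕ (suc k) * inv k)
          ≈⟨ *-cong (recip-inverseʳ _ _) (inv-inverse k) ⟩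
        1# * 1#
          ≈⟨ *-identityˡ 1# ⟩
        1# ∎

    h : Carrier
    h = inv 1

    h+h≈1 : h + h ≈ 1#
    h+h≈1 = begin-equality
      h + h                     ≈⟨ SR.solve 1 (λ h → h SR.:+ h SR.:= (SR.con 1 SR.:+ SR.con 1) SR.:* h) refl h ⟩
      (1# + 1#) * h             ≈⟨ *-congʳ (+-congˡ (+-identityʳ 1#)) ⟨
      fromℕ 2 * h               ≈⟨ inv-inverse 1 ⟩
      1#                        ∎

    half : ∀ z → z * h + z * h ≈ z
    half z = trans (sym (distribˡ z h h)) (trans (*-congˡ h+h≈1) (*-identityʳ z))

    0≤h : 0# ≤ h
    0≤h = inv-nonneg 1

    h≤1 : h ≤ 1#
    h≤1 = begin
      h       ≈⟨ +-identityʳ h ⟨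
      h + 0#  ≤⟨ +-monoʳ-≤ h 0≤h ⟩
      h + h   ≈⟨ h+h≈1 ⟩
      1#      ∎

    h^ : ℕ → Carrier
    h^ zero    = 1#
    h^ (suc j) = h^ j * h

    h^-nonneg : ∀ j → 0# ≤ h^ j
    h^-nonneg zero    = 0≤1
    h^-nonneg (suc j) = *-nonneg (h^-nonneg j) 0≤h

    h^≤1 : ∀ j → h^ j ≤ 1#
    h^≤1 zero    = ≤-refl
    h^≤1 (suc j) = begin
      h^ j * h   ≤⟨ *-monoʳ-≤ h 0≤h (h^≤1 j) ⟩
      1# * h     ≈⟨ *-identityˡ h ⟩
      h          ≤⟨ h≤1 ⟩
      1#         ∎

    j*h^j≤1 : ∀ j → fromℕ j * h^ j ≤ 1#
    j*h^j≤1 zero    = ≤-trans (≤-reflexive (zeroˡ 1#)) 0≤1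
    j*h^j≤1 (suc j) = begin
      (1# + fromℕ j) * (h^ j * h)
        ≈⟨ SR.solve 3 (λ n p h → (SR.con 1 SR.:+ n) SR.:* (p SR.:* h) SR.:= p SR.:* h SR.:+ (n SR.:* p) SR.:* h)
             refl (fromℕ j) (h^ j) h ⟩
      h^ j * h + (fromℕ j * h^ j) * h
        ≤⟨ +-mono-≤ (*-monoʳ-≤ h 0≤h (h^≤1 j)) (*-monoʳ-≤ h 0≤h (j*h^j≤1 j)) ⟩
      1# * h + 1# * h
        ≈⟨ half 1# ⟩
      1# ∎

    module Tail (x : Carrier) where
      M : ℕ
      M = proj₁ (archimedean-bound x)

      L : ℕ
      L = M ℕ.+ M

      ratio : ∀ k → L ℕ.≤ k → (x * inv k) BoundedBy h
      ratio k L≤k = BoundedBy-resp refl bound (BoundedBy-* (proj₂ (archimedean-bound x)) ib)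
        where
        ib : inv k BoundedBy inv k
        ib = ≤-trans (≤-trans (-‿anti-≤ (inv-nonneg k)) (≤-reflexive -0#≈0#)) (inv-nonneg k) , ≤-refl
        bound : fromℕ M * inv k ≤ h
        bound = begin
          fromℕ M * inv k
            ≈⟨ half _ ⟨
          fromℕ M * inv k * h + fromℕ M * inv k * h
            ≈⟨ SR.solve 3 (λ m i h → m SR.:* i SR.:* h SR.:+ m SR.:* i SR.:* h SR.:= (m SR.:+ m) SR.:* (i SR.:* h))
                 refl (fromℕ M) (inv k) h ⟩
          (fromℕ M + fromℕ M) * (inv k * h)
            ≈⟨ *-congʳ (fromℕ-+ M M) ⟨
          fromℕ L * (inv k * h)
            ≤⟨ *-monoʳ-≤ _ (*-nonneg (inv-nonneg k) 0≤h) (fromℕ-mono (ℕₚ.≤-trans L≤k (ℕₚ.n≤1+n k))) ⟩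
          fromℕ (suc k) * (inv k * h)
            ≈⟨ *-assoc _ _ _ ⟨
          fromℕ (suc k) * inv k * h
            ≈⟨ *-congʳ (inv-inverse k) ⟩
          1# * h
            ≈⟨ *-identityˡ h ⟩
          h ∎

      K₀ : ℕ
      K₀ = proj₁ (archimedean-bound (expTerm x L))

      K : Carrier
      K = fromℕ K₀ + fromℕ K₀

      e : ℕ → Carrier
      e j = K * h^ j

      e-half : ∀ j → e (suc j) + e (suc j) ≈ e j
      e-half j = trans (+-cong (sym (*-assoc _ _ _)) (sym (*-assoc _ _ _))) (half (e j))

      e-nonneg : ∀ j → 0# ≤ e j
      e-nonneg j = *-nonneg
        (≤-trans (≤-reflexive (sym (+-identityˡ 0#))) (+-mono-≤ (fromℕ-nonneg K₀) (fromℕ-nonneg K₀)))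
        (h^-nonneg j)

      term-bound : ∀ j → expTerm x (j ℕ.+ L) BoundedBy e (suc j)
      term-bound zero    = BoundedBy-resp refl (≤-reflexive (begin-equality
        fromℕ K₀                           ≈⟨ half _ ⟨
        fromℕ K₀ * h + fromℕ K₀ * h
          ≈⟨ SR.solve 2 (λ k h → k SR.:* h SR.:+ k SR.:* h SR.:= (k SR.:+ k) SR.:* (SR.con 1 SR.:* h))
               refl (fromℕ K₀) h ⟩
        K * (1# * h)                       ∎)) (proj₂ (archimedean-bound (expTerm x L)))
      term-bound (suc j) = BoundedBy-resp (expTerm-suc x (j ℕ.+ L)) (≤-reflexive (*-assoc _ _ _))
        (BoundedBy-* (term-bound j) (ratio (j ℕ.+ L) (ℕₚ.m≤n+m L j)))

      s lo hi : ℕ → Carrier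
      s j  = expSum x (j ℕ.+ L)
      lo j = s j + - e j
      hi j = s j + e j

      lo-step : ∀ j → lo j ≤ lo (suc j)
      lo-step j = begin
        s j + - e j                                  ≈⟨ +-congˡ (-‿cong (e-half j)) ⟨
        s j + - (e (suc j) + e (suc j))              ≈⟨ +-congˡ (-‿+-comm _ _) ⟨
        s j + (- e (suc j) + - e (suc j))            ≈⟨ +-assoc _ _ _ ⟨
        s j + - e (suc j) + - e (suc j)
          ≤⟨ +-monoˡ-≤ _ (+-monoʳ-≤ (s j) (proj₁ (term-bound j))) ⟩
        s j + expTerm x (j ℕ.+ L) + - e (suc j)      ∎

      hi-step : ∀ j → hi (suc j) ≤ hi j
      hi-step j = begin
        s j + expTerm x (j ℕ.+ L) + e (suc j)
          ≤⟨ +-monoˡ-≤ _ (+-monoʳ-≤ (s j) (proj₂ (term-bound j))) ⟩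
        s j + e (suc j) + e (suc j)                  ≈⟨ +-assoc _ _ _ ⟩
        s j + (e (suc j) + e (suc j))                ≈⟨ +-congˡ (e-half j) ⟩
        s j + e j                                    ∎

      lo-mono : ∀ i j → lo j ≤ lo (i ℕ.+ j)
      lo-mono zero    j = ≤-refl
      lo-mono (suc i) j = ≤-trans (lo-mono i j) (lo-step (i ℕ.+ j))

      hi-mono : ∀ i j → hi (i ℕ.+ j) ≤ hi j
      hi-mono zero    j = ≤-refl
      hi-mono (suc i) j = ≤-trans (hi-step (i ℕ.+ j)) (hi-mono i j)

      s≤hi : ∀ j → s j ≤ hi j
      s≤hi j = ≤-trans (≤-reflexive (sym (+-identityʳ (s j)))) (+-monoʳ-≤ (s j) (e-nonneg j))

      lo≤s : ∀ j → lo j ≤ s j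
      lo≤s j = ≤-trans (+-monoʳ-≤ (s j) (≤-trans (-‿anti-≤ (e-nonneg j)) (≤-reflexive -0#≈0#)))
        (≤-reflexive (+-identityʳ (s j)))

      close : ∀ J i j → s (i ℕ.+ J) - s (j ℕ.+ J) ≤ e J + e J
      close J i j = begin
        s (i ℕ.+ J) + - s (j ℕ.+ J)
          ≤⟨ +-mono-≤ (≤-trans (s≤hi (i ℕ.+ J)) (hi-mono i J))
                      (-‿anti-≤ (≤-trans (lo-mono j J) (lo≤s (j ℕ.+ J)))) ⟩
        (s J + e J) + - (s J + - e J)
          ≈⟨ +-congˡ (-‿+-comm (s J) (- e J)) ⟨
        (s J + e J) + (- s J + - - e J)
          ≈⟨ +-congˡ (+-congˡ (-‿involutive (e J))) ⟩
        (s J + e J) + (- s J + e J)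
          ≈⟨ SR.solve 3 (λ s s′ e → (s SR.:+ e) SR.:+ (s′ SR.:+ e) SR.:= (s SR.:+ s′) SR.:+ (e SR.:+ e))
               refl (s J) (- s J) (e J) ⟩
        (s J + - s J) + (e J + e J)
          ≈⟨ trans (+-congʳ (-‿inverseʳ (s J))) (+-identityˡ _) ⟩
        e J + e J ∎

      h^-pos : ∀ j → 0# < h^ j
      h^-pos zero    = 0<1
      h^-pos (suc j) = *-pos (h^-pos j) 0<h
        where
        0<h : 0# < h
        0<h with <-cotrans 0<1 h
        ... | inj₁ 0<h = 0<h
        ... | inj₂ h<1 = begin-strict
          0#            <⟨ x<y⇒0<y-x h<1 ⟩
          1# + - h      ≈⟨ +-congʳ h+h≈1 ⟨
          h + h + - h   ≈⟨ x+y-y≈x h h ⟩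
          h             ∎

      small : ∀ ε → 0# < ε → ∃[ J ] e J + e J < ε
      small ε 0<ε with archimedean ((K + K) * recip ε 0<ε)
      ... | J , lt = J , (begin-strict
        e J + e J              ≈⟨ distribʳ (h^ J) K K ⟨
        (K + K) * h^ J         <⟨ *-monoʳ-< (h^ J) (h^-pos J) K+K<Jε ⟩
        (fromℕ J * ε) * h^ J
          ≈⟨ SR.solve 3 (λ j ε p → (j SR.:* ε) SR.:* p SR.:= (j SR.:* p) SR.:* ε) refl (fromℕ J) ε (h^ J) ⟩
        (fromℕ J * h^ J) * ε   ≤⟨ *-monoʳ-≤ ε (<⇒≤ 0<ε) (j*h^j≤1 J) ⟩
        1# * ε                 ≈⟨ *-identityˡ ε ⟩
        ε                      ∎)
        where
        K+K<Jε : K + K < fromℕ J * ε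
        K+K<Jε = begin-strict
          K + K                          ≈⟨ *-identityʳ _ ⟨
          (K + K) * 1#                   ≈⟨ *-congˡ (trans (*-comm _ _) (recip-inverseʳ ε 0<ε)) ⟨
          (K + K) * (recip ε 0<ε * ε)    ≈⟨ *-assoc _ _ _ ⟨
          (K + K) * recip ε 0<ε * ε      <⟨ *-monoʳ-< ε 0<ε lt ⟩
          fromℕ J * ε                    ∎

  open SeriesBounds

  expSum-cauchy : ∀ x → IsCauchy (expSum x)
  expSum-cauchy x ε 0<ε = J ℕ.+ L , λ i j N≤i N≤j → bound i j N≤i N≤j , bound j i N≤j N≤i
    where
    open Tail x
    J : ℕ
    J = proj₁ (small ε 0<ε)
    at : ∀ i → J ℕ.+ L ℕ.≤ i → ∃[ i′ ] expSum x i ≡.≡ s (i′ ℕ.+ J)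
    at i N≤i = i ℕ.∸ (J ℕ.+ L) , ≡.cong (expSum x)
      (≡.sym (≡.trans (ℕₚ.+-assoc (i ℕ.∸ (J ℕ.+ L)) J L) (ℕₚ.m∸n+n≡m N≤i)))
    bound : ∀ i j → J ℕ.+ L ℕ.≤ i → J ℕ.+ L ℕ.≤ j → expSum x i - expSum x j < ε
    bound i j N≤i N≤j with at i N≤i | at j N≤j
    ... | i′ , eqᵢ | j′ , eqⱼ rewrite eqᵢ | eqⱼ = ≤-<-trans (close J i′ j′) (proj₂ (small ε 0<ε))

  exp : Carrier → Carrier
  exp x = proj₁ (complete (expSum x) (expSum-cauchy x))

  exp-converges : ∀ x → ConvergesTo (expSum x) (exp x)
  exp-converges x = proj₂ (complete (expSum x) (expSum-cauchy x))

module SetFunctions {c ℓ₁ ℓ₂} (ℛ : Reals c ℓ₁ ℓ₂) where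
  open Reals ℛ
  open OrderedField ℛ using (recip)
  open Exponential ℛ using (exp)

  Nonnegative : ∀ {n} → (Subset n → Carrier) → Set ℓ₂
  Nonnegative f = ∀ S → 0# ≤ f S

  Monotone : ∀ {n} → (Subset n → Carrier) → Set ℓ₂
  Monotone f = ∀ S T → S ⊆ T → f S ≤ f T

  Submodular : ∀ {n} → (Subset n → Carrier) → Set ℓ₂
  Submodular f = ∀ S T → f (S ∪ T) + f (S ∩ T) ≤ f S + f T

  sumOver : ∀ {n} → Subset n → (Fin n → Carrier) → Carrier
  sumOver S g = sum λ v → if does (v ∈? S) then g v else 0#

  sumSubsets : ∀ {n} → (Subset n → Carrier) → Carrier
  sumSubsets {zero}  g = g []
  sumSubsets {suc n} g = sumSubsets (g ∘ (inside ∷_)) + sumSubsets (g ∘ (outside ∷_))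

  inclusionProb : ∀ {n} → Vector Carrier n → Fin n → Carrier
  inclusionProb A u = 1# - exp (- A u)

  -- The law of R(A): since the elements are included independently,
  -- P[R(A) = S] = ∏_{u ∈ S} p_u · ∏_{u ∉ S} (1 - p_u).
  probability : ∀ {n} → Vector Carrier n → Subset n → Carrier
  probability A S = product λ u →
    if does (u ∈? S) then inclusionProb A u else 1# - inclusionProb A u

  -- f̂(A) = E[f(R(A))]
  extension : ∀ {n} → (Subset n → Carrier) → Vector Carrier n → Carrier
  extension f A = sumSubsets λ S → probability A S * f S

  increase : ∀ {n} → Vector Carrier n → Fin n → Carrier → Vector Carrier n
  increase A u t = updateAt A u (_+ t)

  -- lim_{t → 0⁺} q(t) = l, for q defined on positive arguments only.
  RightLimitAt0 : ((t : Carrier) → 0# < t → Carrier) → Carrier → Set (c ⊔ ℓ₂)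
  RightLimitAt0 q l = ∀ ε → 0# < ε →
    ∃[ δ ] 0# < δ × (∀ t (0<t : 0# < t) → t < δ → Within ε (q t 0<t) l)

  -- IsMarginal f A u l says that the limit defining f̂(u|A) exists and is l.
  IsMarginal : ∀ {n} → (Subset n → Carrier) → Vector Carrier n → Fin n → Carrier → Set (c ⊔ ℓ₂)
  IsMarginal f A u = RightLimitAt0 λ t 0<t →
    (extension f (increase A u t) - extension f A) * recip t 0<t

module Submission where

-- Raising A u by t amounts to inserting u into R(A) independently with
-- probability 1 - e⁻ᵗ, so f̂(A ⊕ (u,[t])) - f̂(A) = (1 - e⁻ᵗ) E[f(R(A) ∪ {u}) - f(R(A))].
-- Since (1 - e⁻ᵗ) / t tends to 1, the marginal f̂(u|A) is that expected gain, and
-- the inequality is the expectation over S = R(A) of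
-- f(O) ≤ f(S ∪ O) ≤ f(S) + ∑_{v ∈ O} (f(S ∪ {v}) - f(S)).

open import Algebra.Bundles using (CommutativeRing; RawRing)
import Algebra.Properties.Ring as RingProperties
import Algebra.Properties.Semiring.Mult.TCOptimised as Multiples
import Algebra.Properties.Semiring.Sum as SemiringSum
import Algebra.Solver.Ring as RingSolver
open import Algebra.Solver.Ring.AlmostCommutativeRing using (_-Raw-AlmostCommutative⟶_; fromCommutativeRing)
import Algebra.Solver.Ring.NaturalCoefficients.Default as SemiringSolver
open import Data.Bool.Base using (true; false; if_then_else_)
open import Data.Fin.Base using (Fin; zero; suc)
open import Data.Fin.Properties using (suc-injective)
open import Data.Fin.Subset using (Subset; Side; inside; outside; _∪_; _∩_; ⁅_⁆; ⊥)
open import Data.Fin.Subset.Properties using (_∈?_; ∪-identityʳ; ∪-assoc; ∪-idem; ∩-abs-∪; q⊆p∪q)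
open import Data.Maybe.Base using (Maybe; nothing; just)
open import Data.Nat.Base as ℕ using (ℕ; zero; suc; _!)
import Data.Nat.Properties as ℕₚ
open import Data.Product.Base using (Σ; ∃-syntax; _×_; _,_; proj₁; proj₂; swap)
open import Data.Vec.Base using ([]; _∷_)
open import Data.Vec.Functional using (Vector)
open import Data.Vec.Functional.Properties using (updateAt-updates; updateAt-minimal)
open import Function.Base using (_∘_)
open import Relation.Binary.PropositionalEquality.Core as ≡ using (_≡_; _≢_)
open import Relation.Nullary.Decidable.Core using (does; yes; no)
open import Defs

-- The exponential is available only as the limit that completeness assigns to its power series, so
-- whatever is used about it has to be derived from partial sums. Two facts are needed. The
-- functional equation makes the probability of missing `u` pick up exactly the factor e⁻ᵗ; it rests
-- on the Cauchy product, whose truncation error is dominated by a stretch of the series at a larger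
-- nonnegative argument. The estimate |(1 - e⁻ᵗ)/t - 1| ≤ t for 0 < t < 1 gives the limit with an
-- explicit δ; it comes from 1 + t ≤ eᵗ and, by comparison with the geometric series, 1 - t ≤ e⁻ᵗ.
-- The strict order is only cotransitive, so signs cannot be split on. Magnitudes are therefore
-- controlled by `BoundedBy`, a pair of weak inequalities that adds and multiplies, in place of
-- absolute values, and sums of bounds stand in for maxima.

-- Coefficients are formal differences of natural numbers, so that the solver cancels x - x.
-- They are kept in lowest terms because it compares evaluated normal forms definitionally.
module IntegerSolver {c ℓ} (R : CommutativeRing c ℓ) where
  open CommutativeRing R
  open RingProperties ring using (-0#≈0#; -‿involutive; -‿+-comm; -‿distribˡ-*; -‿distribʳ-*)
  open Multiples semiring using (×-homo-+; ×1-homo-*) renaming (_×_ to _×ᴿ_)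
  open import Relation.Binary.Reasoning.Setoid setoid
  private
    module SR = SemiringSolver commutativeSemiring

    reduce : ℕ → ℕ → ℕ × ℕ
    reduce (suc a) (suc b) = reduce a b
    reduce a       b       = a , b

    Difference : RawRing _ _
    Difference = record
      { Carrier = ℕ × ℕ
      ; _≈_     = _≡_
      ; _+_     = λ (a , b) (c , d) → reduce (a ℕ.+ c) (b ℕ.+ d)
      ; _*_     = λ (a , b) (c , d) → reduce (a ℕ.* c ℕ.+ b ℕ.* d) (a ℕ.* d ℕ.+ b ℕ.* c)
      ; -_      = swap
      ; 0#      = 0 , 0
      ; 1#      = 1 , 0
      }

    ι : ℕ → Carrier
    ι n = n ×ᴿ 1#

    -- The first clause makes the constant 1 denote 1# definitionally.
    ⟦_⟧ : ℕ × ℕ → Carrier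
    ⟦ a , zero  ⟧ = ι a
    ⟦ a , suc b ⟧ = ι a - ι (suc b)

    ⟦⟧≈- : ∀ a b → ⟦ a , b ⟧ ≈ ι a - ι b
    ⟦⟧≈- a zero    = sym (trans (+-congˡ -0#≈0#) (+-identityʳ _))
    ⟦⟧≈- a (suc b) = refl

    cancel : ∀ x y z → (x + z) + (- y + - z) ≈ x - y
    cancel x y z = begin
      (x + z) + (- y + - z)
        ≈⟨ SR.solve 4 (λ x z y′ z′ → (x SR.:+ z) SR.:+ (y′ SR.:+ z′) SR.:= (x SR.:+ y′) SR.:+ (z SR.:+ z′))
             refl x z (- y) (- z) ⟩
      (x - y) + (z - z)    ≈⟨ +-congˡ (-‿inverseʳ z) ⟩
      (x - y) + 0#         ≈⟨ +-identityʳ _ ⟩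
      x - y                ∎

    reduce-≈ : ∀ a b → ⟦ reduce a b ⟧ ≈ ι a - ι b
    reduce-≈ (suc a) (suc b) = begin
      ⟦ reduce a b ⟧           ≈⟨ reduce-≈ a b ⟩
      ι a - ι b                ≈⟨ cancel (ι a) (ι b) 1# ⟨
      (ι a + 1#) + (- ι b + - 1#)
        ≈⟨ +-cong (ι-suc a) (trans (-‿+-comm _ _) (-‿cong (ι-suc b))) ⟩
      ι (suc a) - ι (suc b)    ∎
      where
      ι-suc : ∀ n → ι n + 1# ≈ ι (suc n)
      ι-suc n = trans (+-comm _ _) (sym (×-homo-+ 1# 1 n))
    reduce-≈ zero    b       = ⟦⟧≈- 0 b
    reduce-≈ (suc a) zero    = ⟦⟧≈- (suc a) 0

    +-homo : ∀ p q → ⟦ RawRing._+_ Difference p q ⟧ ≈ ⟦ p ⟧ + ⟦ q ⟧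
    +-homo (a , b) (c , d) = begin
      ⟦ reduce (a ℕ.+ c) (b ℕ.+ d) ⟧   ≈⟨ reduce-≈ (a ℕ.+ c) (b ℕ.+ d) ⟩
      ι (a ℕ.+ c) - ι (b ℕ.+ d)        ≈⟨ +-cong (×-homo-+ 1# a c) (-‿cong (×-homo-+ 1# b d)) ⟩
      (ι a + ι c) - (ι b + ι d)        ≈⟨ +-congˡ (-‿+-comm (ι b) (ι d)) ⟨
      (ι a + ι c) + (- ι b + - ι d)
        ≈⟨ SR.solve 4 (λ a b c d → (a SR.:+ c) SR.:+ (b SR.:+ d) SR.:= (a SR.:+ b) SR.:+ (c SR.:+ d))
             refl (ι a) (- ι b) (ι c) (- ι d) ⟩
      (ι a - ι b) + (ι c - ι d)        ≈⟨ +-cong (⟦⟧≈- a b) (⟦⟧≈- c d) ⟨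
      ⟦ a , b ⟧ + ⟦ c , d ⟧            ∎

    ι-homo : ∀ a b c d → ι (a ℕ.* b ℕ.+ c ℕ.* d) ≈ ι a * ι b + ι c * ι d
    ι-homo a b c d = trans (×-homo-+ 1# (a ℕ.* b) (c ℕ.* d)) (+-cong (×1-homo-* a b) (×1-homo-* c d))

    *-homo : ∀ p q → ⟦ RawRing._*_ Difference p q ⟧ ≈ ⟦ p ⟧ * ⟦ q ⟧
    *-homo (a , b) (c , d) = begin
      ⟦ reduce (a ℕ.* c ℕ.+ b ℕ.* d) (a ℕ.* d ℕ.+ b ℕ.* c) ⟧
        ≈⟨ reduce-≈ (a ℕ.* c ℕ.+ b ℕ.* d) (a ℕ.* d ℕ.+ b ℕ.* c) ⟩
      ι (a ℕ.* c ℕ.+ b ℕ.* d) - ι (a ℕ.* d ℕ.+ b ℕ.* c)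
        ≈⟨ +-cong (ι-homo a c b d) (-‿cong (ι-homo a d b c)) ⟩
      (ι a * ι c + ι b * ι d) - (ι a * ι d + ι b * ι c)
        ≈⟨ +-cong (+-congˡ (sym bd)) (trans (sym (-‿+-comm _ _)) (+-cong (-‿distribʳ-* _ _) (-‿distribˡ-* _ _))) ⟩
      (ι a * ι c + - ι b * - ι d) + (ι a * - ι d + - ι b * ι c)
        ≈⟨ SR.solve 4 (λ a b c d →
             (a SR.:* c SR.:+ b SR.:* d) SR.:+ (a SR.:* d SR.:+ b SR.:* c) SR.:= (a SR.:+ b) SR.:* (c SR.:+ d))
             refl (ι a) (- ι b) (ι c) (- ι d) ⟩
      (ι a - ι b) * (ι c - ι d)        ≈⟨ *-cong (⟦⟧≈- a b) (⟦⟧≈- c d) ⟨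
      ⟦ a , b ⟧ * ⟦ c , d ⟧            ∎
      where
      bd : - ι b * - ι d ≈ ι b * ι d
      bd = trans (sym (-‿distribˡ-* _ _)) (trans (-‿cong (sym (-‿distribʳ-* _ _))) (-‿involutive _))

    -‿homo : ∀ p → ⟦ swap p ⟧ ≈ - ⟦ p ⟧
    -‿homo (a , b) = begin
      ⟦ b , a ⟧          ≈⟨ ⟦⟧≈- b a ⟩
      ι b - ι a          ≈⟨ +-comm _ _ ⟩
      - ι a + ι b        ≈⟨ +-congˡ (-‿involutive (ι b)) ⟨
      - ι a + - - ι b    ≈⟨ -‿+-comm _ _ ⟩
      - (ι a - ι b)      ≈⟨ -‿cong (⟦⟧≈- a b) ⟨
      - ⟦ a , b ⟧        ∎

    homomorphism : Difference -Raw-AlmostCommutative⟶ fromCommutativeRing R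
    homomorphism = record
      { ⟦_⟧    = ⟦_⟧
      ; +-homo = +-homo
      ; *-homo = *-homo
      ; -‿homo = -‿homo
      ; 0-homo = refl
      ; 1-homo = refl
      }

    ⟦⟧-cong : ∀ a b c d → a ℕ.+ d ≡ c ℕ.+ b → ⟦ a , b ⟧ ≈ ⟦ c , d ⟧
    ⟦⟧-cong a b c d eq = begin
      ⟦ a , b ⟧                          ≈⟨ ⟦⟧≈- a b ⟩
      ι a - ι b                          ≈⟨ cancel (ι a) (ι b) (ι d) ⟨
      (ι a + ι d) + (- ι b + - ι d)      ≈⟨ +-congʳ (×-homo-+ 1# a d) ⟨
      ι (a ℕ.+ d) + (- ι b + - ι d)      ≡⟨ ≡.cong (λ z → ι z + (- ι b + - ι d)) eq ⟩
      ι (c ℕ.+ b) + (- ι b + - ι d)      ≈⟨ +-cong (×-homo-+ 1# c b) (+-comm _ _) ⟩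
      (ι c + ι b) + (- ι d + - ι b)      ≈⟨ cancel (ι c) (ι d) (ι b) ⟩
      ι c - ι d                          ≈⟨ ⟦⟧≈- c d ⟨
      ⟦ c , d ⟧                          ∎

    _≟_ : ∀ p q → Maybe (⟦ p ⟧ ≈ ⟦ q ⟧)
    (a , b) ≟ (c , d) with a ℕ.+ d ℕₚ.≟ c ℕ.+ b
    ... | yes eq = just (⟦⟧-cong a b c d eq)
    ... | no _   = nothing

  open RingSolver Difference (fromCommutativeRing R) homomorphism _≟_ public
    using (solve; _:=_; _:+_; _:*_; _:-_; :-_; con)

-- Sequences tending to zero, and limits controlled through them.

module NullSequences {c ℓ₁ ℓ₂} (ℛ : Reals c ℓ₁ ℓ₂) where
  open Reals ℛ
  open OrderedField ℛ
  open Exponential.SeriesBounds ℛ using (h; half)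
  open SetFunctions ℛ using (RightLimitAt0)
  open ≤-Reasoning
  open IntegerSolver commutativeRing

  0<h : 0# < h
  0<h = recip-pos _ _

  *-monoˡ-≤ : ∀ {x y} z → 0# ≤ z → x ≤ y → z * x ≤ z * y
  *-monoˡ-≤ {x} {y} z 0≤z x≤y =
    ≤-trans (≤-reflexive (*-comm z x)) (≤-trans (*-monoʳ-≤ z 0≤z x≤y) (≤-reflexive (*-comm y z)))

  +-nonneg : ∀ {x y} → 0# ≤ x → 0# ≤ y → 0# ≤ x + y
  +-nonneg 0≤x 0≤y = ≤-trans (≤-reflexive (sym (+-identityˡ 0#))) (+-mono-≤ 0≤x 0≤y)

  0≤⇒BoundedBy : ∀ {x} → 0# ≤ x → x BoundedBy x
  0≤⇒BoundedBy 0≤x = ≤-trans (≤-trans (-‿anti-≤ 0≤x) (≤-reflexive -0#≈0#)) 0≤x , ≤-refl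

  -- A negative `y` would satisfy y < - y, against - y ≤ x ≤ y.
  BoundedBy⇒nonneg : ∀ {x y} → x BoundedBy y → 0# ≤ y
  BoundedBy⇒nonneg {x} {y} (-y≤x , x≤y) y<0 = ≤-trans -y≤x x≤y (begin-strict
    y        <⟨ y<0 ⟩
    0#       ≈⟨ -‿inverseʳ y ⟨
    y - y    <⟨ +-monoˡ-< (- y) y<0 ⟩
    0# - y   ≈⟨ +-identityˡ _ ⟩
    - y      ∎)

  BoundedBy-+ : ∀ {a b y d} → a BoundedBy b → y BoundedBy d → (a + y) BoundedBy (b + d)
  BoundedBy-+ (p , q) (r , s) =
    ≤-trans (≤-reflexive (sym (-‿+-comm _ _))) (+-mono-≤ p r) , +-mono-≤ q s

  -- Weak two-sided bounds, unlike `Within`, are inherited by dominated sequences and multiply with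
  -- bounded ones, so limit arguments are run on differences in this form.
  Null : (ℕ → Carrier) → Set _
  Null s = ∀ ε → 0# < ε → ∃[ N ] ∀ i → N ℕ.≤ i → s i BoundedBy ε

  Null-cong : ∀ {s t : ℕ → Carrier} K → (∀ i → K ℕ.≤ i → s i ≈ t i) → Null s → Null t
  Null-cong K s≈t s→0 ε 0<ε with s→0 ε 0<ε
  ... | N , close = N ℕ.+ K , λ i N+K≤i → BoundedBy-resp (s≈t i (ℕₚ.≤-trans (ℕₚ.m≤n+m K N) N+K≤i)) ≤-refl
                                (close i (ℕₚ.≤-trans (ℕₚ.m≤m+n N K) N+K≤i))

  Null-dominated : ∀ {s t : ℕ → Carrier} → (∀ i → s i BoundedBy t i) → Null t → Null s
  Null-dominated s≤t t→0 ε 0<ε with t→0 ε 0<ε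
  ... | N , close = N , λ i N≤i → BoundedBy-resp refl (proj₂ (close i N≤i)) (s≤t i)

  Null-neg : ∀ {s} → Null s → Null (λ i → - s i)
  Null-neg s→0 ε 0<ε with s→0 ε 0<ε
  ... | N , close = N , λ i N≤i → BoundedBy-neg (close i N≤i)

  Null-+ : ∀ {s t} → Null s → Null t → Null (λ i → s i + t i)
  Null-+ s→0 t→0 ε 0<ε with s→0 (ε * h) (*-pos 0<ε 0<h) | t→0 (ε * h) (*-pos 0<ε 0<h)
  ... | N , close | N′ , close′ = N ℕ.+ N′ , λ i N+N′≤i → BoundedBy-resp refl (≤-reflexive (half ε))
    (BoundedBy-+ (close i (ℕₚ.≤-trans (ℕₚ.m≤m+n N N′) N+N′≤i))
                 (close′ i (ℕₚ.≤-trans (ℕₚ.m≤n+m N′ N) N+N′≤i)))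

  scale-recip : ∀ ε K (0<K : 0# < K) → ε * recip K 0<K * K ≈ ε
  scale-recip ε K 0<K = trans (*-assoc _ _ _)
    (trans (*-congˡ (trans (*-comm _ _) (recip-inverseʳ K 0<K))) (*-identityʳ ε))

  Null-* : ∀ {s} {t : ℕ → Carrier} B → Null s → (∀ i → t i BoundedBy B) → Null (λ i → s i * t i)
  Null-* {s} {t} B s→0 t≤B ε 0<ε = proj₁ s→0′ , λ i N≤i →
    BoundedBy-resp refl (≤-reflexive (scale-recip ε K 0<K))
      (BoundedBy-* (proj₂ s→0′ i N≤i) (BoundedBy-resp refl B≤K (t≤B i)))
    where
    -- The successor makes the bound visibly positive, so ε can be divided by it.
    K = fromℕ (suc (proj₁ (archimedean B)))
    0<K : 0# < K
    0<K = fromℕ-pos {suc (proj₁ (archimedean B))} (ℕ.s≤s ℕ.z≤n)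
    B≤K : B ≤ K
    B≤K = ≤-trans (<⇒≤ (proj₂ (archimedean B))) (fromℕ-mono {proj₁ (archimedean B)} (ℕₚ.n≤1+n _))
    s→0′ = s→0 (ε * recip K 0<K) (*-pos 0<ε (recip-pos K 0<K))

  x≤ε⇒x≤0 : ∀ {x} → (∀ ε → 0# < ε → x ≤ ε) → x ≤ 0#
  x≤ε⇒x≤0 {x} x≤ε 0<x = x≤ε (x * h) 0<xh (begin-strict
    x * h             ≈⟨ +-identityˡ _ ⟨
    0# + x * h        <⟨ +-monoˡ-< (x * h) 0<xh ⟩
    x * h + x * h     ≈⟨ half x ⟩
    x                 ∎)
    where
    0<xh : 0# < x * h
    0<xh = *-pos 0<x 0<h

  -- Uniqueness of limits reduces to this: a difference of two candidate limits is a constant that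
  -- equals a combination of null sequences.
  Null-const : ∀ {x} → Null (λ _ → x) → x ≈ 0#
  Null-const {x} x→0 = ≤-antisym (x≤ε⇒x≤0 λ ε 0<ε → proj₂ (bound ε 0<ε))
    (≤-trans (≤-reflexive (sym -0#≈0#)) (≤-trans (-‿anti-≤ -x≤0) (≤-reflexive (-‿involutive x))))
    where
    bound : ∀ ε → 0# < ε → x BoundedBy ε
    bound ε 0<ε = proj₂ (x→0 ε 0<ε) _ ℕₚ.≤-refl
    -x≤0 : - x ≤ 0#
    -x≤0 = x≤ε⇒x≤0 λ ε 0<ε → proj₂ (BoundedBy-neg (bound ε 0<ε))

  Within⇒BoundedBy : ∀ {ε x y} → Within ε x y → (x - y) BoundedBy ε
  Within⇒BoundedBy {ε} {x} {y} (x-y<ε , y-x<ε) =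
    ≤-trans (-‿anti-≤ (<⇒≤ y-x<ε)) (≤-reflexive (solve 2 (λ x y → :- (y :- x) := x :- y) refl x y)) , <⇒≤ x-y<ε

  ConvergesTo⇒Null : ∀ {s l} → ConvergesTo s l → Null (λ i → s i - l)
  ConvergesTo⇒Null s→l ε 0<ε with s→l ε 0<ε
  ... | N , close = N , λ i N≤i → Within⇒BoundedBy (close i N≤i)

  -- Meant for φ i = i + i, where it makes the stretch of a convergent series between N and 2N
  -- vanish.
  IsCauchy⇒Null : ∀ {s} (φ : ℕ → ℕ) → (∀ i → i ℕ.≤ φ i) → IsCauchy s → Null (λ i → s (φ i) - s i)
  IsCauchy⇒Null φ i≤φi cauchy ε 0<ε with cauchy ε 0<ε
  ... | N , close = N , λ i N≤i → Within⇒BoundedBy (close (φ i) i (ℕₚ.≤-trans N≤i (i≤φi i)) N≤i)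

  -- A failure b < l supplies the tolerance l - b, and a term closer to `l` than that would exceed
  -- `b`.
  ConvergesTo-≤ : ∀ {s l b} K → (∀ i → K ℕ.≤ i → s i ≤ b) → ConvergesTo s l → l ≤ b
  ConvergesTo-≤ {s} {l} {b} K s≤b s→l b<l with s→l (l - b) (x<y⇒0<y-x b<l)
  ... | N , close = +-monoʳ-≤ l (-‿anti-≤ (s≤b (N ℕ.+ K) (ℕₚ.m≤n+m K N)))
                      (proj₂ (close (N ℕ.+ K) (ℕₚ.m≤m+n N K)))

  ConvergesTo-≥ : ∀ {s l b} K → (∀ i → K ℕ.≤ i → b ≤ s i) → ConvergesTo s l → b ≤ l
  ConvergesTo-≥ {s} {l} {b} K b≤s s→l l<b with s→l (b - l) (x<y⇒0<y-x l<b)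
  ... | N , close = +-monoˡ-≤ (- l) (b≤s (N ℕ.+ K) (ℕₚ.m≤n+m K N))
                      (proj₁ (close (N ℕ.+ K) (ℕₚ.m≤m+n N K)))

  -- Asking only that s t - u be null, rather than zero, is what truncated series can deliver. The
  -- difference z - x y telescopes through (s - x) t, (t - y) x, s t - u and u - z; the bound `B`
  -- serves the first of these.
  product-limit-unique : ∀ {s t u : ℕ → Carrier} {x y z B} → ConvergesTo s x → ConvergesTo t y → ConvergesTo u z →
    (∀ i → t i BoundedBy B) → Null (λ i → s i * t i - u i) → z ≈ x * y
  product-limit-unique {s} {t} {u} {x} {y} {z} {B} s→x t→y u→z t≤B st-u→0 =
    trans (sym (x-y+y≈x z (x * y))) (trans (+-congʳ (Null-const z-xy→0)) (+-identityˡ (x * y)))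
    where
    z-xy→0 : Null (λ _ → z - x * y)
    z-xy→0 = Null-cong 0
      (λ i _ → solve 6 (λ s x t y u z →
         ((s :- x) :* t :+ (t :- y) :* x) :- (s :* t :- u) :- (u :- z) := z :- x :* y)
         refl (s i) x (t i) y (u i) z)
      (Null-+ (Null-+ (Null-+ (Null-* B (ConvergesTo⇒Null s→x) t≤B)
                              (Null-* _ (ConvergesTo⇒Null t→y) (λ _ → proj₂ (archimedean-bound x))))
                      (Null-neg st-u→0))
              (Null-neg (ConvergesTo⇒Null u→z)))

  ConvergesTo-unique : ∀ {s t : ℕ → Carrier} {l m} K → (∀ i → K ℕ.≤ i → s i ≈ t i) →
    ConvergesTo s l → ConvergesTo t m → l ≈ m
  ConvergesTo-unique {s} {t} {l} {m} K s≈t s→l t→m =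
    trans (sym (x-y+y≈x l m)) (trans (+-congʳ (Null-const l-m→0)) (+-identityˡ m))
    where
    l-m→0 : Null (λ _ → l - m)
    l-m→0 = Null-cong K
      (λ i K≤i → trans (+-congˡ (-‿cong (+-congʳ (s≈t i K≤i))))
        (solve 3 (λ t l m → (t :- m) :- (t :- l) := l :- m) refl (t i) l m))
      (Null-+ (ConvergesTo⇒Null t→m) (Null-neg (ConvergesTo⇒Null s→l)))

  ConvergesTo-const : ∀ x → ConvergesTo (λ _ → x) x
  ConvergesTo-const x ε 0<ε = 0 , λ _ _ → <-respˡ-≈ (sym (-‿inverseʳ x)) 0<ε , <-respˡ-≈ (sym (-‿inverseʳ x)) 0<ε


  -- One radius does the work of two: with δ = 1/(1 + B/ε), t < δ gives t + tB/ε < 1, hence both t <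
  -- 1 and tB < ε, also when `B` is 0.
  RightLimitAt0-linear : ∀ {q : (t : Carrier) → 0# < t → Carrier} {l B} → 0# ≤ B →
    (∀ t (0<t : 0# < t) → t < 1# → (q t 0<t - l) BoundedBy (t * B)) → RightLimitAt0 q l
  RightLimitAt0-linear {q} {l} {B} 0≤B linear ε 0<ε = recip M 0<M , recip-pos M 0<M , close
    where
    r M : Carrier
    r = recip ε 0<ε
    M = 1# + B * r
    0<M : 0# < M
    0<M = <-≤-trans 0<1 (≤-trans (≤-reflexive (sym (+-identityʳ 1#)))
      (+-monoʳ-≤ 1# (*-nonneg 0≤B (recip-nonneg _ _))))
    close : ∀ t (0<t : 0# < t) → t < recip M 0<M → Within ε (q t 0<t) l
    close t 0<t t<δ = ≤-<-trans (proj₂ bound) tB<ε , ≤-<-trans l-q≤tB tB<ε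
      where
      0≤tB : 0# ≤ t * B
      0≤tB = *-nonneg (<⇒≤ 0<t) 0≤B
      t+tBr<1 : t + t * B * r < 1#
      t+tBr<1 = begin-strict
        t + t * B * r       ≈⟨ solve 3 (λ t B r → t :+ t :* B :* r := t :* (con (1 , 0) :+ B :* r)) refl t B r ⟩
        t * M               <⟨ *-monoʳ-< M 0<M t<δ ⟩
        recip M 0<M * M     ≈⟨ trans (*-comm _ _) (recip-inverseʳ M 0<M) ⟩
        1#                  ∎
      t<1 : t < 1#
      t<1 = ≤-<-trans (≤-trans (≤-reflexive (sym (+-identityʳ t)))
        (+-monoʳ-≤ t (*-nonneg 0≤tB (recip-nonneg _ _)))) t+tBr<1
      tB<ε : t * B < ε
      tB<ε = begin-strict
        t * B               ≈⟨ *-identityʳ _ ⟨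
        t * B * 1#          ≈⟨ *-congˡ (recip-inverseʳ ε 0<ε) ⟨
        t * B * (ε * r)     ≈⟨ solve 4 (λ t B ε r → t :* B :* (ε :* r) := (con (0 , 0) :+ t :* B :* r) :* ε) refl t B ε r ⟩
        (0# + t * B * r) * ε <⟨ *-monoʳ-< ε 0<ε (<-trans (+-monoˡ-< _ 0<t) t+tBr<1) ⟩
        1# * ε              ≈⟨ *-identityˡ ε ⟩
        ε                   ∎
      bound : (q t 0<t - l) BoundedBy (t * B)
      bound = linear t 0<t t<1
      l-q≤tB : l - q t 0<t ≤ t * B
      l-q≤tB = ≤-trans (≤-reflexive (solve 2 (λ l q → l :- q := :- (q :- l)) refl l (q t 0<t)))
        (proj₂ (BoundedBy-neg bound))

-- Cauchy products and their truncations by triangles and rectangles.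

module Convolution {c ℓ₁ ℓ₂} (ℛ : Reals c ℓ₁ ℓ₂) where
  open Reals ℛ
  open OrderedField ℛ
  open NullSequences ℛ
  open ≤-Reasoning
  open IntegerSolver commutativeRing

  partialSum : (ℕ → Carrier) → ℕ → Carrier
  partialSum a zero    = 0#
  partialSum a (suc k) = partialSum a k + a k

  convolution : (ℕ → Carrier) → (ℕ → Carrier) → ℕ → Carrier
  convolution a b zero    = a 0 * b 0
  convolution a b (suc k) = a 0 * b (suc k) + convolution (a ∘ suc) b k

  -- The sum of a i * b j over i + j < N.
  triangleSum : (ℕ → Carrier) → (ℕ → Carrier) → ℕ → Carrier
  triangleSum a b zero    = 0#
  triangleSum a b (suc N) = a 0 * partialSum b (suc N) + triangleSum (a ∘ suc) b N

  partialSum-head : ∀ a N → partialSum a (suc N) ≈ a 0 + partialSum (a ∘ suc) N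
  partialSum-head a zero    = +-comm _ _
  partialSum-head a (suc N) = trans (+-congʳ (partialSum-head a N)) (+-assoc _ _ _)

  -- The recursion of `triangleSum` peels off the first row; peeling off the last antidiagonal
  -- instead identifies the triangle with a partial sum of the Cauchy product.
  triangleSum-last : ∀ a b N → triangleSum a b (suc N) ≈ triangleSum a b N + convolution a b N
  triangleSum-last a b zero    = solve 2 (λ a b → a :* (con (0 , 0) :+ b) :+ con (0 , 0) := con (0 , 0) :+ a :* b) refl (a 0) (b 0)
  triangleSum-last a b (suc N) = begin-equality
    a 0 * partialSum b (2 ℕ.+ N) + triangleSum (a ∘ suc) b (suc N)
      ≈⟨ +-congˡ (triangleSum-last (a ∘ suc) b N) ⟩
    a 0 * (partialSum b (suc N) + b (suc N)) + (triangleSum (a ∘ suc) b N + convolution (a ∘ suc) b N)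
      ≈⟨ solve 5 (λ a s b t c → a :* (s :+ b) :+ (t :+ c) := (a :* s :+ t) :+ (a :* b :+ c)) refl
           (a 0) (partialSum b (suc N)) (b (suc N)) (triangleSum (a ∘ suc) b N) (convolution (a ∘ suc) b N) ⟩
    triangleSum a b (suc N) + convolution a b (suc N) ∎

  triangleSum≈partialSum : ∀ a b N → triangleSum a b N ≈ partialSum (convolution a b) N
  triangleSum≈partialSum a b zero    = refl
  triangleSum≈partialSum a b (suc N) = trans (triangleSum-last a b N) (+-congʳ (triangleSum≈partialSum a b N))

  convolution-cong : ∀ {a a′ b b′} → (∀ i → a i ≈ a′ i) → (∀ j → b j ≈ b′ j) →
                     ∀ k → convolution a b k ≈ convolution a′ b′ k
  convolution-cong a≈a′ b≈b′ zero    = *-cong (a≈a′ 0) (b≈b′ 0)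
  convolution-cong a≈a′ b≈b′ (suc k) =
    +-cong (*-cong (a≈a′ 0) (b≈b′ (suc k))) (convolution-cong (a≈a′ ∘ suc) b≈b′ k)

  convolution-*ˡ : ∀ x a b k → convolution (λ i → x * a i) b k ≈ x * convolution a b k
  convolution-*ˡ x a b zero    = *-assoc _ _ _
  convolution-*ˡ x a b (suc k) =
    trans (+-cong (*-assoc _ _ _) (convolution-*ˡ x (a ∘ suc) b k)) (sym (distribˡ _ _ _))

  convolution-*ʳ : ∀ x a b k → convolution a (λ j → x * b j) k ≈ x * convolution a b k
  convolution-*ʳ x a b zero    = solve 3 (λ x a b → a :* (x :* b) := x :* (a :* b)) refl x (a 0) (b 0)
  convolution-*ʳ x a b (suc k) = trans (+-congˡ (convolution-*ʳ x (a ∘ suc) b k))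
    (solve 4 (λ x a b c → a :* (x :* b) :+ x :* c := x :* (a :* b :+ c)) refl
      x (a 0) (b (suc k)) (convolution (a ∘ suc) b k))

  -- Meant for coefficients weighted by their index, whose constant term vanishes; dropping it
  -- realises the index shift of a formal derivative.
  convolution-zeroˡ : ∀ a b k → a 0 ≈ 0# → convolution a b (suc k) ≈ convolution (a ∘ suc) b k
  convolution-zeroˡ a b k a₀≈0 = trans (+-congʳ (trans (*-congʳ a₀≈0) (zeroˡ _))) (+-identityˡ _)

  convolution-zeroʳ : ∀ a b k → b 0 ≈ 0# → convolution a b (suc k) ≈ convolution a (b ∘ suc) k
  convolution-zeroʳ a b zero    b₀≈0 = trans (+-congˡ (trans (*-congˡ b₀≈0) (zeroʳ _))) (+-identityʳ _)
  convolution-zeroʳ a b (suc k) b₀≈0 = +-congˡ (convolution-zeroʳ (a ∘ suc) b k b₀≈0)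

  -- The Leibniz rule for formal power series, where the offset w makes the induction go through.
  convolution-weighted : ∀ w a b k →
    convolution (λ i → (w + fromℕ i) * a i) b k + convolution a (λ j → fromℕ j * b j) k
      ≈ (w + fromℕ k) * convolution a b k
  convolution-weighted w a b zero    =
    solve 3 (λ w a b → (w :+ con (0 , 0)) :* a :* b :+ a :* (con (0 , 0) :* b) := (w :+ con (0 , 0)) :* (a :* b))
      refl w (a 0) (b 0)
  convolution-weighted w a b (suc k) = begin-equality
    ((w + 0#) * a 0 * b (suc k) + convolution (λ i → (w + fromℕ (suc i)) * a (suc i)) b k)
      + (a 0 * (fromℕ (suc k) * b (suc k)) + convolution (a ∘ suc) (λ j → fromℕ j * b j) k)
      ≈⟨ +-congʳ (+-congˡ (convolution-cong (λ i → *-congʳ (sym (+-assoc w 1# (fromℕ i)))) (λ _ → refl) k)) ⟩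
    ((w + 0#) * a 0 * b (suc k) + convolution (λ i → (w + 1# + fromℕ i) * a (suc i)) b k)
      + (a 0 * (fromℕ (suc k) * b (suc k)) + convolution (a ∘ suc) (λ j → fromℕ j * b j) k)
      ≈⟨ solve 6 (λ w a b p n q → ((w :+ con (0 , 0)) :* a :* b :+ p) :+ (a :* (n :* b) :+ q)
                               := (w :+ n) :* (a :* b) :+ (p :+ q)) refl
           w (a 0) (b (suc k)) (convolution (λ i → (w + 1# + fromℕ i) * a (suc i)) b k) (fromℕ (suc k))
           (convolution (a ∘ suc) (λ j → fromℕ j * b j) k) ⟩
    (w + fromℕ (suc k)) * (a 0 * b (suc k))
      + (convolution (λ i → (w + 1# + fromℕ i) * a (suc i)) b k + convolution (a ∘ suc) (λ j → fromℕ j * b j) k)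
      ≈⟨ +-congˡ (convolution-weighted (w + 1#) (a ∘ suc) b k) ⟩
    (w + fromℕ (suc k)) * (a 0 * b (suc k)) + (w + 1# + fromℕ k) * convolution (a ∘ suc) b k
      ≈⟨ +-congˡ (*-congʳ (+-assoc w 1# (fromℕ k))) ⟩
    (w + fromℕ (suc k)) * (a 0 * b (suc k)) + (w + fromℕ (suc k)) * convolution (a ∘ suc) b k
      ≈⟨ distribˡ _ _ _ ⟨
    (w + fromℕ (suc k)) * convolution a b (suc k) ∎

  partialSum-nonneg : ∀ {a} → (∀ i → 0# ≤ a i) → ∀ N → 0# ≤ partialSum a N
  partialSum-nonneg 0≤a zero    = ≤-refl
  partialSum-nonneg 0≤a (suc N) = +-nonneg (partialSum-nonneg 0≤a N) (0≤a N)

  partialSum-mono : ∀ {a} → (∀ i → 0# ≤ a i) → ∀ K N → partialSum a N ≤ partialSum a (K ℕ.+ N)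
  partialSum-mono 0≤a zero    N = ≤-refl
  partialSum-mono 0≤a (suc K) N = ≤-trans (partialSum-mono 0≤a K N)
    (≤-trans (≤-reflexive (sym (+-identityʳ _))) (+-monoʳ-≤ _ (0≤a (K ℕ.+ N))))

  partialSum-BoundedBy : ∀ {a a′} → (∀ i → a i BoundedBy a′ i) → ∀ N → partialSum a N BoundedBy partialSum a′ N
  partialSum-BoundedBy a≤a′ zero    = 0≤⇒BoundedBy ≤-refl
  partialSum-BoundedBy a≤a′ (suc N) = BoundedBy-+ (partialSum-BoundedBy a≤a′ N) (a≤a′ N)

  partialSum-gap : ∀ {a a′} → (∀ i → a i BoundedBy a′ i) → ∀ K N →
    (partialSum a (K ℕ.+ N) - partialSum a N) BoundedBy (partialSum a′ (K ℕ.+ N) - partialSum a′ N)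
  partialSum-gap a≤a′ zero    N = BoundedBy-resp (sym (-‿inverseʳ _)) (≤-reflexive (sym (-‿inverseʳ _))) (0≤⇒BoundedBy ≤-refl)
  partialSum-gap {a} {a′} a≤a′ (suc K) N = BoundedBy-resp (shift a) (≤-reflexive (shift a′))
    (BoundedBy-+ (partialSum-gap a≤a′ K N) (a≤a′ (K ℕ.+ N)))
    where
    shift : ∀ s → partialSum s (K ℕ.+ N) - partialSum s N + s (K ℕ.+ N) ≈ partialSum s (suc K ℕ.+ N) - partialSum s N
    shift s = solve 3 (λ p q r → p :- q :+ r := p :+ r :- q) refl
      (partialSum s (K ℕ.+ N)) (partialSum s N) (s (K ℕ.+ N))

  -- The rectangle of size (M + N) × (K + N) contains the triangle of size N.
  rectangle-triangle-gap : ∀ {a a′ b b′} → (∀ i → a i BoundedBy a′ i) → (∀ j → b j BoundedBy b′ j) → ∀ K M N →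
    (partialSum a (N ℕ.+ M) * partialSum b (K ℕ.+ N) - triangleSum a b N)
      BoundedBy (partialSum a′ (N ℕ.+ M) * partialSum b′ (K ℕ.+ N) - triangleSum a′ b′ N)
  rectangle-triangle-gap {a} {a′} {b} {b′} a≤a′ b≤b′ K M zero =
    BoundedBy-resp (minus0 _) (≤-reflexive (minus0 _))
      (BoundedBy-* (partialSum-BoundedBy a≤a′ M) (partialSum-BoundedBy b≤b′ (K ℕ.+ 0)))
    where
    minus0 : ∀ x → x ≈ x - 0#
    minus0 x = solve 1 (λ x → x := x :- con (0 , 0)) refl x
  rectangle-triangle-gap {a} {a′} {b} {b′} a≤a′ b≤b′ K M (suc N) =
    BoundedBy-resp (split a b) (≤-reflexive (split a′ b′))
      (BoundedBy-+ (BoundedBy-* (a≤a′ 0) (partialSum-gap b≤b′ K (suc N)))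
        -- The triangle shrinks by one while the rectangle keeps its width, so the excess grows: K +
        -- suc N has to be read as suc K + N.
        (≡.subst (λ L → (partialSum (a ∘ suc) (N ℕ.+ M) * partialSum b L - triangleSum (a ∘ suc) b N)
                        BoundedBy (partialSum (a′ ∘ suc) (N ℕ.+ M) * partialSum b′ L - triangleSum (a′ ∘ suc) b′ N))
          (≡.sym (ℕₚ.+-suc K N)) (rectangle-triangle-gap (a≤a′ ∘ suc) b≤b′ (suc K) M N)))
    where
    split : ∀ a b →
      a 0 * (partialSum b (K ℕ.+ suc N) - partialSum b (suc N))
        + (partialSum (a ∘ suc) (N ℕ.+ M) * partialSum b (K ℕ.+ suc N) - triangleSum (a ∘ suc) b N)
      ≈ partialSum a (suc N ℕ.+ M) * partialSum b (K ℕ.+ suc N) - triangleSum a b (suc N)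
    split a b = trans
      (solve 5 (λ a B b A t → a :* (B :- b) :+ (A :* B :- t) := (a :+ A) :* B :- (a :* b :+ t)) refl
        (a 0) (partialSum b (K ℕ.+ suc N)) (partialSum b (suc N)) (partialSum (a ∘ suc) (N ℕ.+ M))
        (triangleSum (a ∘ suc) b N))
      (+-congʳ (*-congʳ (sym (partialSum-head a (N ℕ.+ M)))))

  -- Indices i < M and j < N satisfy i + j < M + N, and the remaining terms of the triangle are
  -- nonnegative.
  square-≤-triangle : ∀ {a b} → (∀ i → 0# ≤ a i) → (∀ j → 0# ≤ b j) → ∀ M N →
    partialSum a M * partialSum b N ≤ triangleSum a b (M ℕ.+ N)
  square-≤-triangle {a} {b} 0≤a 0≤b zero N = begin
    0# * partialSum b N      ≈⟨ zeroˡ _ ⟩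
    0#                       ≤⟨ triangle-nonneg 0≤a N ⟩
    triangleSum a b N        ∎
    where
    triangle-nonneg : ∀ {a} → (∀ i → 0# ≤ a i) → ∀ N → 0# ≤ triangleSum a b N
    triangle-nonneg 0≤a zero    = ≤-refl
    triangle-nonneg 0≤a (suc N) =
      +-nonneg (*-nonneg (0≤a 0) (partialSum-nonneg 0≤b (suc N))) (triangle-nonneg (0≤a ∘ suc) N)
  square-≤-triangle {a} {b} 0≤a 0≤b (suc M) N = begin
    partialSum a (suc M) * partialSum b N
      ≈⟨ *-congʳ (partialSum-head a M) ⟩
    (a 0 + partialSum (a ∘ suc) M) * partialSum b N
      ≈⟨ distribʳ _ _ _ ⟩
    a 0 * partialSum b N + partialSum (a ∘ suc) M * partialSum b N
      ≤⟨ +-mono-≤ (*-monoˡ-≤ (a 0) (0≤a 0) (partialSum-mono 0≤b (suc M) N))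
                  (square-≤-triangle (0≤a ∘ suc) 0≤b M N) ⟩
    triangleSum a b (suc M ℕ.+ N) ∎

-- Partial sums of the exponential series and their products.

module ExponentialSeries {c ℓ₁ ℓ₂} (ℛ : Reals c ℓ₁ ℓ₂) where
  open Reals ℛ
  open OrderedField ℛ
  open Exponential ℛ hiding (exp; exp-converges)
  open SeriesBounds using (inv; inv-inverse; expTerm-suc)
  open NullSequences ℛ
  open Convolution ℛ
  open ≤-Reasoning
  open IntegerSolver commutativeRing

  expSum≡partialSum : ∀ x N → expSum x N ≡ partialSum (expTerm x) N
  expSum≡partialSum x zero    = ≡.refl
  expSum≡partialSum x (suc N) = ≡.cong (_+ expTerm x N) (expSum≡partialSum x N)

  -- The differential equation F' = xF of F(z) = exp(xz), read off coefficientwise.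
  fromℕ-*-expTerm : ∀ x k → fromℕ (suc k) * expTerm x (suc k) ≈ x * expTerm x k
  fromℕ-*-expTerm x k = begin-equality
    fromℕ (suc k) * expTerm x (suc k)               ≈⟨ *-congˡ (expTerm-suc x k) ⟨
    fromℕ (suc k) * (expTerm x k * (x * inv k))
      ≈⟨ solve 4 (λ n e x i → n :* (e :* (x :* i)) := (n :* i) :* (x :* e)) refl
           (fromℕ (suc k)) (expTerm x k) x (inv k) ⟩
    (fromℕ (suc k) * inv k) * (x * expTerm x k)     ≈⟨ *-congʳ (inv-inverse k) ⟩
    1# * (x * expTerm x k)                          ≈⟨ *-identityˡ _ ⟩
    x * expTerm x k                                 ∎

  expTerm-zero : ∀ x → expTerm x 0 ≈ 1#
  expTerm-zero x = trans (*-identityˡ _) (sym (recip-unique _ _ 1# (trans (*-identityʳ _) (+-identityʳ 1#))))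

  -- Both sides satisfy (k + 1) c (k + 1) = (x + y) c k.
  expTerm-+ : ∀ x y k → convolution (expTerm x) (expTerm y) k ≈ expTerm (x + y) k
  expTerm-+ x y zero    = trans (trans (*-cong (expTerm-zero x) (expTerm-zero y)) (*-identityˡ 1#))
                                (sym (expTerm-zero (x + y)))
  expTerm-+ x y (suc k) = begin-equality
    conv (suc k)                                ≈⟨ *-identityˡ _ ⟨
    1# * conv (suc k)                           ≈⟨ *-congʳ (inv-inverse k) ⟨
    (fromℕ (suc k) * inv k) * conv (suc k)
      -- The summand 0# is the offset `w` at which the Leibniz rule is applied.
      ≈⟨ solve 3 (λ n i c → (n :* i) :* c := ((con (0 , 0) :+ n) :* c) :* i) refl (fromℕ (suc k)) (inv k) (conv (suc k)) ⟩
    ((0# + fromℕ (suc k)) * conv (suc k)) * inv k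
      ≈⟨ *-congʳ (convolution-weighted 0# (expTerm x) (expTerm y) (suc k)) ⟨
    (convolution (λ i → (0# + fromℕ i) * expTerm x i) (expTerm y) (suc k)
      + convolution (expTerm x) (λ j → fromℕ j * expTerm y j) (suc k)) * inv k
      -- The terms of index 0 carry weight 0, so both convolutions drop to length `k`, where the
      -- recurrence for `expTerm` applies.
      ≈⟨ *-congʳ (+-cong (convolution-zeroˡ (λ i → (0# + fromℕ i) * expTerm x i) (expTerm y) k (trans (*-congʳ (+-identityˡ 0#)) (zeroˡ _)))
                         (convolution-zeroʳ (expTerm x) (λ j → fromℕ j * expTerm y j) k (zeroˡ _))) ⟩
    (convolution (λ i → (0# + fromℕ (suc i)) * expTerm x (suc i)) (expTerm y) k
      + convolution (expTerm x) (λ j → fromℕ (suc j) * expTerm y (suc j)) k) * inv k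
      ≈⟨ *-congʳ (+-cong
           (convolution-cong (λ i → trans (*-congʳ (+-identityˡ _)) (fromℕ-*-expTerm x i)) (λ _ → refl) k)
           (convolution-cong (λ _ → refl) (fromℕ-*-expTerm y) k)) ⟩
    (convolution (λ i → x * expTerm x i) (expTerm y) k
      + convolution (expTerm x) (λ j → y * expTerm y j) k) * inv k
      ≈⟨ *-congʳ (+-cong (convolution-*ˡ x (expTerm x) (expTerm y) k) (convolution-*ʳ y (expTerm x) (expTerm y) k)) ⟩
    (x * conv k + y * conv k) * inv k
      ≈⟨ solve 4 (λ x y c i → (x :* c :+ y :* c) :* i := c :* ((x :+ y) :* i)) refl x y (conv k) (inv k) ⟩
    conv k * ((x + y) * inv k)                  ≈⟨ *-congʳ (expTerm-+ x y k) ⟩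
    expTerm (x + y) k * ((x + y) * inv k)       ≈⟨ expTerm-suc (x + y) k ⟩
    expTerm (x + y) (suc k)                     ∎
    where
    conv : ℕ → Carrier
    conv = convolution (expTerm x) (expTerm y)

  -- Truncation by total degree makes the product rule exact at every finite stage; only the square
  -- truncation in `expSum x N * expSum y N` leaves an error.
  expSum-+ : ∀ x y N → triangleSum (expTerm x) (expTerm y) N ≈ expSum (x + y) N
  expSum-+ x y N = trans (triangleSum≈partialSum (expTerm x) (expTerm y) N) (go N)
    where
    go : ∀ N → partialSum (convolution (expTerm x) (expTerm y)) N ≈ expSum (x + y) N
    go zero    = refl
    go (suc N) = +-cong (go N) (expTerm-+ x y N)

  ^-BoundedBy : ∀ {x b} → x BoundedBy b → ∀ k → (x ^ k) BoundedBy (b ^ k)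
  ^-BoundedBy x≤b zero    = 0≤⇒BoundedBy 0≤1
  ^-BoundedBy x≤b (suc k) = BoundedBy-* x≤b (^-BoundedBy x≤b k)

  expTerm-BoundedBy : ∀ {x b} → x BoundedBy b → ∀ k → expTerm x k BoundedBy expTerm b k
  expTerm-BoundedBy x≤b k = BoundedBy-* (^-BoundedBy x≤b k) (0≤⇒BoundedBy (recip-nonneg _ _))

  expTerm-nonneg : ∀ {x} → 0# ≤ x → ∀ k → 0# ≤ expTerm x k
  expTerm-nonneg 0≤x k = BoundedBy⇒nonneg (expTerm-BoundedBy (0≤⇒BoundedBy 0≤x) k)

  expSum-BoundedBy : ∀ {x b} → x BoundedBy b → ∀ N → expSum x N BoundedBy expSum b N
  expSum-BoundedBy {x} {b} x≤b N rewrite expSum≡partialSum x N | expSum≡partialSum b N =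
    partialSum-BoundedBy (expTerm-BoundedBy x≤b) N

  expSum-mono : ∀ {x} → 0# ≤ x → ∀ K N → expSum x N ≤ expSum x (K ℕ.+ N)
  expSum-mono {x} 0≤x K N rewrite expSum≡partialSum x N | expSum≡partialSum x (K ℕ.+ N) =
    partialSum-mono (expTerm-nonneg 0≤x) K N

  -- The error collects the products with i, j < N and i + j ≥ N, so replacing `x` and `y` by `b`
  -- dominates it. For `b` the triangle is `expSum (b + b) N`, and the square lies inside the
  -- triangle of size N + N, which leaves a stretch of a single Cauchy sequence.
  expSum-*-gap : ∀ {x y b} → x BoundedBy b → y BoundedBy b → ∀ N →
    (expSum x N * expSum y N - expSum (x + y) N) BoundedBy (expSum (b + b) (N ℕ.+ N) - expSum (b + b) N)
  expSum-*-gap {x} {y} {b} x≤b y≤b N = BoundedBy-resp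
    (square-gap x y)
    (≤-trans (≤-reflexive (square-gap b b)) (+-monoˡ-≤ _ square≤))
    -- With both excesses 0 the rectangle is the N × N square.
    (rectangle-triangle-gap (expTerm-BoundedBy x≤b) (expTerm-BoundedBy y≤b) 0 0 N)
    where
    0≤b : 0# ≤ b
    0≤b = BoundedBy⇒nonneg x≤b
    square-gap : ∀ x y →
      partialSum (expTerm x) (N ℕ.+ 0) * partialSum (expTerm y) N - triangleSum (expTerm x) (expTerm y) N
        ≈ expSum x N * expSum y N - expSum (x + y) N
    square-gap x y rewrite ℕₚ.+-identityʳ N | expSum≡partialSum x N | expSum≡partialSum y N =
      +-congˡ (-‿cong (expSum-+ x y N))
    square≤ : expSum b N * expSum b N ≤ expSum (b + b) (N ℕ.+ N)
    square≤ rewrite expSum≡partialSum b N =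
      ≤-trans (square-≤-triangle (expTerm-nonneg 0≤b) (expTerm-nonneg 0≤b) N N)
              (≤-reflexive (expSum-+ b b (N ℕ.+ N)))

  expSum-*-Null : ∀ x y → Null (λ N → expSum x N * expSum y N - expSum (x + y) N)
  expSum-*-Null x y = Null-dominated (expSum-*-gap {x} {y} {b} x≤b y≤b) tail→0
    where
    j k : ℕ
    j = proj₁ (archimedean-bound x)
    k = proj₁ (archimedean-bound y)
    b : Carrier
    -- The sum of the two integer bounds stands in for their maximum.
    b = fromℕ (j ℕ.+ k)
    x≤b : x BoundedBy b
    x≤b = BoundedBy-resp refl (fromℕ-mono {j} {j ℕ.+ k} (ℕₚ.m≤m+n j k)) (proj₂ (archimedean-bound x))
    y≤b : y BoundedBy b
    y≤b = BoundedBy-resp refl (fromℕ-mono {k} {j ℕ.+ k} (ℕₚ.m≤n+m k j)) (proj₂ (archimedean-bound y))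
    tail→0 : Null (λ N → expSum (b + b) (N ℕ.+ N) - expSum (b + b) N)
    tail→0 = IsCauchy⇒Null (λ N → N ℕ.+ N) (λ N → ℕₚ.m≤m+n N N) (expSum-cauchy (b + b))

  ^-cong : ∀ {x y} → x ≈ y → ∀ k → x ^ k ≈ y ^ k
  ^-cong x≈y zero    = refl
  ^-cong x≈y (suc k) = *-cong x≈y (^-cong x≈y k)

  expSum-cong : ∀ {x y} → x ≈ y → ∀ N → expSum x N ≈ expSum y N
  expSum-cong x≈y zero    = refl
  expSum-cong x≈y (suc N) = +-cong (expSum-cong x≈y N) (*-congʳ (^-cong x≈y N))

-- The functional equation of exp and its behaviour near zero.

-- exp is taken to be any sum of the series, which keeps the concrete limit from unfolding.
module ExponentialProperties {c ℓ₁ ℓ₂} (ℛ : Reals c ℓ₁ ℓ₂)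
  (exp : Reals.Carrier ℛ → Reals.Carrier ℛ)
  (exp-converges : ∀ x → Reals.ConvergesTo ℛ (Exponential.expSum ℛ x) (exp x)) where
  open Reals ℛ
  open OrderedField ℛ
  open Exponential ℛ hiding (exp; exp-converges)
  open NullSequences ℛ
  open ≤-Reasoning
  open IntegerSolver commutativeRing
  open ExponentialSeries ℛ

  expSum≤exp : ∀ {x} → 0# ≤ x → ∀ N → expSum x N ≤ exp x
  expSum≤exp {x} 0≤x N = ConvergesTo-≥ N mono (exp-converges x)
    where
    mono : ∀ i → N ℕ.≤ i → expSum x N ≤ expSum x i
    mono i N≤i = ≡.subst (λ j → expSum x N ≤ expSum x j) (ℕₚ.m∸n+n≡m N≤i) (expSum-mono 0≤x (i ℕ.∸ N) N)

  exp-+ : ∀ x y → exp (x + y) ≈ exp x * exp y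
  exp-+ x y = product-limit-unique (exp-converges x) (exp-converges y) (exp-converges (x + y))
    expSum-y≤ (expSum-*-Null x y)
    where
    -- The sign of `y` is unknown, so the bound is taken at a natural number above |y|, where all
    -- partial sums stay below their limit.
    expSum-y≤ : ∀ i → expSum y i BoundedBy exp (fromℕ (proj₁ (archimedean-bound y)))
    expSum-y≤ i = BoundedBy-resp refl (expSum≤exp (fromℕ-nonneg (proj₁ (archimedean-bound y))) i)
      (expSum-BoundedBy (proj₂ (archimedean-bound y)) i)

  exp-cong : ∀ {x y} → x ≈ y → exp x ≈ exp y
  exp-cong {x} {y} x≈y =
    ConvergesTo-unique 0 (λ i _ → expSum-cong x≈y i) (exp-converges x) (exp-converges y)

  exp-0 : exp 0# ≈ 1#
  exp-0 = ConvergesTo-unique 1 expSum-0 (exp-converges 0#) (ConvergesTo-const 1#)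
    where
    expSum-0 : ∀ i → 1 ℕ.≤ i → expSum 0# i ≈ 1#
    expSum-0 (suc zero)    _ = trans (+-identityˡ _) (expTerm-zero 0#)
    expSum-0 (suc (suc i)) _ = trans (+-cong (expSum-0 (suc i) (ℕ.s≤s ℕ.z≤n))
      (trans (*-congʳ (zeroˡ (0# ^ i))) (zeroˡ _))) (+-identityʳ 1#)

  -- At negative arguments the series alternates; sign and upper bound are read off instead from
  -- exp(-x) being the reciprocal of exp x.
  exp-neg : ∀ x → exp (- x) * exp x ≈ 1#
  exp-neg x = trans (sym (exp-+ (- x) x)) (trans (exp-cong (-‿inverseˡ x)) exp-0)

  1+t≤exp-t : ∀ {t} → 0# ≤ t → 1# + t ≤ exp t
  1+t≤exp-t {t} 0≤t = ≤-trans (≤-reflexive (sym expSum-2)) (expSum≤exp 0≤t 2)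
    where
    expTerm-1 : expTerm t 1 ≈ t
    expTerm-1 = begin-equality
      expTerm t 1                 ≈⟨ *-identityˡ _ ⟨
      1# * expTerm t 1            ≈⟨ *-congʳ (+-identityʳ 1#) ⟨
      fromℕ 1 * expTerm t 1       ≈⟨ fromℕ-*-expTerm t 0 ⟩
      t * expTerm t 0             ≈⟨ *-congˡ (expTerm-zero t) ⟩
      t * 1#                      ≈⟨ *-identityʳ t ⟩
      t                           ∎
    expSum-2 : expSum t 2 ≈ 1# + t
    expSum-2 = +-cong (trans (+-identityˡ _) (expTerm-zero t)) expTerm-1

  1≤exp : ∀ {t} → 0# ≤ t → 1# ≤ exp t
  1≤exp {t} 0≤t = ≤-trans (≤-trans (≤-reflexive (sym (+-identityʳ 1#))) (+-monoʳ-≤ 1# 0≤t)) (1+t≤exp-t 0≤t)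

  exp-neg-nonneg : ∀ {t} → 0# ≤ t → 0# ≤ exp (- t)
  exp-neg-nonneg {t} 0≤t = ≤-trans (recip-nonneg (exp t) 0<exp)
    (≤-reflexive (sym (recip-unique (exp t) 0<exp (exp (- t)) (trans (*-comm _ _) (exp-neg t)))))
    where
    0<exp : 0# < exp t
    0<exp = <-≤-trans 0<1 (1≤exp 0≤t)

  exp-neg≤1 : ∀ {t} → 0# ≤ t → exp (- t) ≤ 1#
  exp-neg≤1 {t} 0≤t = begin
    exp (- t)            ≈⟨ *-identityʳ _ ⟨
    exp (- t) * 1#       ≤⟨ *-monoˡ-≤ (exp (- t)) (exp-neg-nonneg 0≤t) (1≤exp 0≤t) ⟩
    exp (- t) * exp t    ≈⟨ exp-neg t ⟩
    1#                   ∎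

  ^-nonneg : ∀ {t} → 0# ≤ t → ∀ k → 0# ≤ t ^ k
  ^-nonneg 0≤t zero    = 0≤1
  ^-nonneg 0≤t (suc k) = *-nonneg 0≤t (^-nonneg 0≤t k)

  expTerm≤^ : ∀ {t} → 0# ≤ t → ∀ k → expTerm t k ≤ t ^ k
  expTerm≤^ {t} 0≤t k = ≤-trans (*-monoˡ-≤ (t ^ k) (^-nonneg 0≤t k) recip≤1) (≤-reflexive (*-identityʳ _))
    where
    r = recip (fromℕ (k !)) (fromℕ!-pos k)
    recip≤1 : r ≤ 1#
    recip≤1 = begin
      r                   ≈⟨ *-identityˡ r ⟨
      1# * r              ≈⟨ *-congʳ (+-identityʳ 1#) ⟨
      fromℕ 1 * r         ≤⟨ *-monoʳ-≤ r (recip-nonneg _ _) (fromℕ-mono {1} (ℕₚ.1≤n! k)) ⟩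
      fromℕ (k !) * r     ≈⟨ recip-inverseʳ _ _ ⟩
      1#                  ∎

  -- Comparison with the geometric series.
  [1-t]*expSum≤1-t^ : ∀ {t} → 0# ≤ t → t ≤ 1# → ∀ N → (1# - t) * expSum t N ≤ 1# - t ^ N
  [1-t]*expSum≤1-t^ {t} 0≤t t≤1 zero    = ≤-reflexive (trans (zeroʳ _) (sym (-‿inverseʳ 1#)))
  [1-t]*expSum≤1-t^ {t} 0≤t t≤1 (suc N) = begin
    (1# - t) * (expSum t N + expTerm t N)
      ≈⟨ distribˡ _ _ _ ⟩
    (1# - t) * expSum t N + (1# - t) * expTerm t N
      ≤⟨ +-mono-≤ ([1-t]*expSum≤1-t^ 0≤t t≤1 N) (*-monoˡ-≤ _ (x≤y⇒0≤y-x t≤1) (expTerm≤^ 0≤t N)) ⟩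
    (1# - t ^ N) + (1# - t) * t ^ N
      ≈⟨ solve 2 (λ t p → (con (1 , 0) :- p) :+ (con (1 , 0) :- t) :* p := con (1 , 0) :- t :* p) refl t (t ^ N) ⟩
    1# - t * t ^ N ∎

  -- Since exp t · exp(-t) = 1, it is enough that (1 - t) exp t ≤ 1. The geometric comparison bounds
  -- every partial sum of exp t by the constant 1/(1 - t), and a constant bound passes to the limit.
  1-t≤exp-neg : ∀ {t} → 0# ≤ t → t < 1# → 1# - t ≤ exp (- t)
  1-t≤exp-neg {t} 0≤t t<1 = begin
    1# - t                             ≈⟨ *-identityʳ _ ⟨
    (1# - t) * 1#                      ≈⟨ *-congˡ (trans (*-comm _ _) (exp-neg t)) ⟨
    (1# - t) * (exp t * exp (- t))     ≈⟨ *-assoc _ _ _ ⟨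
    (1# - t) * exp t * exp (- t)       ≤⟨ *-monoʳ-≤ _ (exp-neg-nonneg 0≤t) product≤1 ⟩
    1# * exp (- t)                     ≈⟨ *-identityˡ _ ⟩
    exp (- t)                          ∎
    where
    0<1-t : 0# < 1# - t
    0<1-t = x<y⇒0<y-x t<1
    r = recip (1# - t) 0<1-t
    expSum≤r : ∀ i → 0 ℕ.≤ i → expSum t i ≤ r
    expSum≤r i _ = begin
      expSum t i                          ≈⟨ *-identityʳ _ ⟨
      expSum t i * 1#                     ≈⟨ *-congˡ (recip-inverseʳ _ _) ⟨
      expSum t i * ((1# - t) * r)         ≈⟨ trans (sym (*-assoc _ _ _)) (*-congʳ (*-comm _ _)) ⟩
      (1# - t) * expSum t i * r
        ≤⟨ *-monoʳ-≤ r (recip-nonneg _ _) ([1-t]*expSum≤1-t^ 0≤t (<⇒≤ t<1) i) ⟩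
      (1# - t ^ i) * r                    ≤⟨ *-monoʳ-≤ r (recip-nonneg _ _) 1-t^≤1 ⟩
      1# * r                              ≈⟨ *-identityˡ r ⟩
      r                                   ∎
      where
      1-t^≤1 : 1# - t ^ i ≤ 1#
      1-t^≤1 = ≤-trans (+-monoʳ-≤ 1# (-‿anti-≤ (^-nonneg 0≤t i)))
        (≤-reflexive (trans (+-congˡ -0#≈0#) (+-identityʳ 1#)))
    product≤1 : (1# - t) * exp t ≤ 1#
    product≤1 = begin
      (1# - t) * exp t   ≤⟨ *-monoˡ-≤ _ (<⇒≤ 0<1-t) (ConvergesTo-≤ 0 expSum≤r (exp-converges t)) ⟩
      (1# - t) * r       ≈⟨ recip-inverseʳ _ _ ⟩
      1#                 ∎

  -- Write e for exp(-t). From 1 - t ≤ e the quotient is at most 1, so the upper bound has room to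
  -- spare. From e (1 + t) ≤ e · exp t = 1 follows t e ≤ 1 - e, so the quotient is at least e, hence
  -- at least 1 - t.
  [1-exp-neg]/t : ∀ {t} (0<t : 0# < t) → t < 1# → ((1# - exp (- t)) * recip t 0<t - 1#) BoundedBy t
  [1-exp-neg]/t {t} 0<t t<1 = lower , upper
    where
    e r : Carrier
    e = exp (- t)
    r = recip t 0<t
    0≤t : 0# ≤ t
    0≤t = <⇒≤ 0<t
    0≤r : 0# ≤ r
    0≤r = recip-nonneg _ _
    t*e≤1-e : t * e ≤ 1# - e
    t*e≤1-e = begin
      t * e                     ≈⟨ solve 2 (λ t e → t :* e := e :* (con (1 , 0) :+ t) :- e) refl t e ⟩
      e * (1# + t) - e          ≤⟨ +-monoˡ-≤ (- e) (*-monoˡ-≤ e (exp-neg-nonneg 0≤t) (1+t≤exp-t 0≤t)) ⟩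
      e * exp t - e             ≈⟨ +-congʳ (exp-neg t) ⟩
      1# - e                    ∎
    1-e≤t : 1# - e ≤ t
    1-e≤t = ≤-trans (+-monoʳ-≤ 1# (-‿anti-≤ (1-t≤exp-neg 0≤t t<1)))
      (≤-reflexive (solve 1 (λ t → con (1 , 0) :- (con (1 , 0) :- t) := t) refl t))
    lower : - t ≤ (1# - e) * r - 1#
    lower = begin
      - t                       ≈⟨ solve 1 (λ t → :- t := (con (1 , 0) :- t) :- con (1 , 0)) refl t ⟩
      (1# - t) - 1#             ≤⟨ +-monoˡ-≤ _ (1-t≤exp-neg 0≤t t<1) ⟩
      e - 1#                    ≈⟨ +-congʳ (*-identityˡ e) ⟨
      1# * e - 1#               ≈⟨ +-congʳ (*-congʳ (recip-inverseʳ t 0<t)) ⟨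
      t * r * e - 1#            ≈⟨ +-congʳ (solve 3 (λ t r e → t :* r :* e := t :* e :* r) refl t r e) ⟩
      t * e * r - 1#            ≤⟨ +-monoˡ-≤ _ (*-monoʳ-≤ r 0≤r t*e≤1-e) ⟩
      (1# - e) * r - 1#         ∎
    upper : (1# - e) * r - 1# ≤ t
    upper = begin
      (1# - e) * r - 1#         ≤⟨ +-monoˡ-≤ _ (*-monoʳ-≤ r 0≤r 1-e≤t) ⟩
      t * r - 1#                ≈⟨ +-congʳ (recip-inverseʳ t 0<t) ⟩
      1# - 1#                   ≈⟨ -‿inverseʳ 1# ⟩
      0#                        ≤⟨ 0≤t ⟩
      t                         ∎

-- Expectations over random subsets with independent elements.

module Expectation {c ℓ₁ ℓ₂} (ℛ : Reals c ℓ₁ ℓ₂) where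
  open Reals ℛ hiding (zero)
  open OrderedField ℛ
  open SetFunctions ℛ using (Submodular; sumOver; sumSubsets)
  open NullSequences ℛ
  open ≤-Reasoning
  open IntegerSolver commutativeRing
  open SemiringSum semiring using (sum-cong-≋)

  sumSubsets-cong : ∀ {n} {g g′ : Subset n → Carrier} → (∀ S → g S ≈ g′ S) → sumSubsets g ≈ sumSubsets g′
  sumSubsets-cong {zero}  g≈g′ = g≈g′ []
  sumSubsets-cong {suc n} g≈g′ = +-cong (sumSubsets-cong (g≈g′ ∘ (inside ∷_))) (sumSubsets-cong (g≈g′ ∘ (outside ∷_)))

  sumSubsets-*ˡ : ∀ {n} x (g : Subset n → Carrier) → sumSubsets (λ S → x * g S) ≈ x * sumSubsets g
  sumSubsets-*ˡ {zero}  x g = refl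
  sumSubsets-*ˡ {suc n} x g =
    trans (+-cong (sumSubsets-*ˡ x (g ∘ (inside ∷_))) (sumSubsets-*ˡ x (g ∘ (outside ∷_)))) (sym (distribˡ _ _ _))

  -- Arbitrary probabilities let inductions on the ground set discard the first coordinate without
  -- reference to exp.
  bernoulliWeight : ∀ {n} → Vector Carrier n → Subset n → Carrier
  bernoulliWeight p S = product λ u → if does (u ∈? S) then p u else 1# - p u

  expectation : ∀ {n} → Vector Carrier n → (Subset n → Carrier) → Carrier
  expectation p f = sumSubsets λ S → bernoulliWeight p S * f S

  -- Conditioning on element zero: the weight of `s ∷ S` unfolds to a factor for the head times the
  -- weight of `S`, and the head factor leaves the sum. Inductions on the ground set run along this
  -- recursion.
  expectation-step : ∀ {n} (p : Vector Carrier (suc n)) f →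
    expectation p f ≈ p zero * expectation (p ∘ suc) (f ∘ (inside ∷_))
                      + (1# - p zero) * expectation (p ∘ suc) (f ∘ (outside ∷_))
  expectation-step p f = +-cong (side (p zero) (f ∘ (inside ∷_))) (side (1# - p zero) (f ∘ (outside ∷_)))
    where
    side : ∀ x g → sumSubsets (λ S → x * bernoulliWeight (p ∘ suc) S * g S) ≈ x * expectation (p ∘ suc) g
    side x g = trans (sumSubsets-cong λ S → *-assoc x (bernoulliWeight (p ∘ suc) S) (g S)) (sumSubsets-*ˡ x (λ S → bernoulliWeight (p ∘ suc) S * g S))

  expectation-cong : ∀ {n} (p : Vector Carrier n) {f g} → (∀ S → f S ≈ g S) → expectation p f ≈ expectation p g
  expectation-cong p f≈g = sumSubsets-cong λ S → *-congˡ (f≈g S)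

  expectation-mono : ∀ {n} (p : Vector Carrier n) → (∀ u → 0# ≤ p u) → (∀ u → p u ≤ 1#) →
    ∀ {f g} → (∀ S → f S ≤ g S) → expectation p f ≤ expectation p g
  expectation-mono {zero}  p 0≤p p≤1 f≤g = *-monoˡ-≤ 1# 0≤1 (f≤g [])
  expectation-mono {suc n} p 0≤p p≤1 {f} {g} f≤g = begin
    expectation p f      ≈⟨ expectation-step p f ⟩
    _                    ≤⟨ +-mono-≤ (*-monoˡ-≤ (p zero) (0≤p zero) (tail-mono inside))
                                     (*-monoˡ-≤ (1# - p zero) (x≤y⇒0≤y-x (p≤1 zero)) (tail-mono outside)) ⟩
    _                    ≈⟨ expectation-step p g ⟨
    expectation p g      ∎
    where
    tail-mono : ∀ s → expectation (p ∘ suc) (f ∘ (s ∷_)) ≤ expectation (p ∘ suc) (g ∘ (s ∷_))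
    tail-mono s = expectation-mono (p ∘ suc) (0≤p ∘ suc) (p≤1 ∘ suc) (f≤g ∘ (s ∷_))

  -- This is the total mass one of the weights: each coordinate contributes p + (1 - p).
  expectation-const : ∀ {n} (p : Vector Carrier n) x → expectation p (λ _ → x) ≈ x
  expectation-const {zero}  p x = *-identityˡ x
  expectation-const {suc n} p x = trans (expectation-step p (λ _ → x))
    (trans (+-cong (*-congˡ (expectation-const (p ∘ suc) x)) (*-congˡ (expectation-const (p ∘ suc) x)))
      (solve 2 (λ p x → p :* x :+ (con (1 , 0) :- p) :* x := x) refl (p zero) x))

  expectation-+ : ∀ {n} (p : Vector Carrier n) f g →
    expectation p (λ S → f S + g S) ≈ expectation p f + expectation p g
  expectation-+ {zero}  p f g = distribˡ _ _ _
  expectation-+ {suc n} p f g = begin-equality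
    expectation p (λ S → f S + g S)
      ≈⟨ expectation-step p (λ S → f S + g S) ⟩
    _ ≈⟨ +-cong (*-congˡ (expectation-+ (p ∘ suc) (f ∘ (inside ∷_)) (g ∘ (inside ∷_))))
                (*-congˡ (expectation-+ (p ∘ suc) (f ∘ (outside ∷_)) (g ∘ (outside ∷_)))) ⟩
    _ ≈⟨ solve 6 (λ p q a b c d → p :* (a :+ b) :+ q :* (c :+ d) := (p :* a :+ q :* c) :+ (p :* b :+ q :* d)) refl
           (p zero) (1# - p zero)
           (expectation (p ∘ suc) (f ∘ (inside ∷_))) (expectation (p ∘ suc) (g ∘ (inside ∷_)))
           (expectation (p ∘ suc) (f ∘ (outside ∷_))) (expectation (p ∘ suc) (g ∘ (outside ∷_))) ⟩
    _ ≈⟨ +-cong (expectation-step p f) (expectation-step p g) ⟨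
    expectation p f + expectation p g ∎

  expectation-neg : ∀ {n} (p : Vector Carrier n) f → expectation p (λ S → - f S) ≈ - expectation p f
  expectation-neg p f = begin-equality
    expectation p (λ S → - f S)
      ≈⟨ solve 2 (λ x y → x := (y :+ x) :- y) refl (expectation p (λ S → - f S)) (expectation p f) ⟩
    (expectation p f + expectation p (λ S → - f S)) - expectation p f
      ≈⟨ +-congʳ (trans (sym (expectation-+ p f (λ S → - f S)))
           (trans (expectation-cong p (λ S → -‿inverseʳ (f S))) (expectation-const p 0#))) ⟩
    0# - expectation p f      ≈⟨ +-identityˡ _ ⟩
    - expectation p f         ∎

  expectation-congˡ : ∀ {n} {p p′ : Vector Carrier n} f → (∀ u → p u ≡ p′ u) → expectation p f ≈ expectation p′ f
  expectation-congˡ {zero}           f p≡p′ = refl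
  expectation-congˡ {suc n} {p} {p′} f p≡p′ = begin-equality
    expectation p f      ≈⟨ expectation-step p f ⟩
    _                    ≈⟨ +-cong (*-cong p≈p′ (tail-cong inside)) (*-cong (+-congˡ (-‿cong p≈p′)) (tail-cong outside)) ⟩
    _                    ≈⟨ expectation-step p′ f ⟨
    expectation p′ f     ∎
    where
    p≈p′ : p zero ≈ p′ zero
    p≈p′ = reflexive (p≡p′ zero)
    tail-cong : ∀ s → expectation (p ∘ suc) (f ∘ (s ∷_)) ≈ expectation (p′ ∘ suc) (f ∘ (s ∷_))
    tail-cong s = expectation-congˡ (f ∘ (s ∷_)) (p≡p′ ∘ suc)

  expectation-sum : ∀ {n m} (p : Vector Carrier n) (g : Fin m → Subset n → Carrier) →
    expectation p (λ S → sum (λ v → g v S)) ≈ sum (λ v → expectation p (g v))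
  expectation-sum {m = zero}  p g = expectation-const p 0#
  expectation-sum {m = suc m} p g =
    trans (expectation-+ p (g zero) (λ S → sum (λ v → g (suc v) S))) (+-congˡ (expectation-sum p (g ∘ suc)))

  expectation-sumOver : ∀ {n} (p : Vector Carrier n) O (g : Fin n → Subset n → Carrier) →
    expectation p (λ S → sumOver O (λ v → g v S)) ≈ sumOver O (λ v → expectation p (g v))
  expectation-sumOver p O g = trans (expectation-sum p (λ v S → if does (v ∈? O) then g v S else 0#))
    (sum-cong-≋ λ v → choice (does (v ∈? O)) v)
    where
    choice : ∀ b v → expectation p (λ S → if b then g v S else 0#) ≈ (if b then expectation p (g v) else 0#)
    choice true  v = refl
    choice false v = expectation-const p 0#

  gain : ∀ {n} → (Subset n → Carrier) → Fin n → Subset n → Carrier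
  gain f v S = f (S ∪ ⁅ v ⁆) - f S

  -- p′ is the law obtained by also inserting u, independently, with probability 1 - e.
  expectation-insert : ∀ {n} (p p′ : Vector Carrier n) f u e →
    (∀ v → v ≢ u → p′ v ≡ p v) → 1# - p′ u ≈ (1# - p u) * e →
    expectation p′ f - expectation p f ≈ (1# - e) * expectation p (gain f u)
  expectation-insert {suc n} p p′ f zero e p′≡p p′-u = begin-equality
    expectation p′ f - expectation p f
      ≈⟨ +-cong (expectation-step p′ f) (-‿cong (expectation-step p f)) ⟩
    (p′ zero * F₁′ + (1# - p′ zero) * F₀′) - (p zero * F₁ + q * F₀)
      ≈⟨ +-congʳ (+-cong (*-cong p′≈ (tail-≈ inside)) (*-cong p′-u (tail-≈ outside))) ⟩
    ((1# - q * e) * F₁ + q * e * F₀) - (p zero * F₁ + q * F₀)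
      -- The summand `p zero * 0#` is created to match the shape of `expectation-step`: a set
      -- already containing element zero gains nothing.
      ≈⟨ solve 4 (λ p e x y →
           ((con (1 , 0) :- (con (1 , 0) :- p) :* e) :* x :+ (con (1 , 0) :- p) :* e :* y)
             :- (p :* x :+ (con (1 , 0) :- p) :* y)
           := (con (1 , 0) :- e) :* (p :* con (0 , 0) :+ (con (1 , 0) :- p) :* (x :- y)))
           refl (p zero) e F₁ F₀ ⟩
    (1# - e) * (p zero * 0# + q * (F₁ - F₀))
      ≈⟨ *-congˡ (+-cong (*-congˡ inside-gain) (*-congˡ outside-gain)) ⟨
    (1# - e) * (p zero * expectation (p ∘ suc) (gain f zero ∘ (inside ∷_))
                + q * expectation (p ∘ suc) (gain f zero ∘ (outside ∷_)))
      ≈⟨ *-congˡ (expectation-step p (gain f zero)) ⟨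
    (1# - e) * expectation p (gain f zero) ∎
    where
    q F₀ F₁ F₀′ F₁′ : Carrier
    q   = 1# - p zero
    F₁  = expectation (p ∘ suc) (f ∘ (inside ∷_))
    F₀  = expectation (p ∘ suc) (f ∘ (outside ∷_))
    F₁′ = expectation (p′ ∘ suc) (f ∘ (inside ∷_))
    F₀′ = expectation (p′ ∘ suc) (f ∘ (outside ∷_))
    p′≈ : p′ zero ≈ 1# - q * e
    p′≈ = trans (solve 1 (λ x → x := con (1 , 0) :- (con (1 , 0) :- x)) refl (p′ zero)) (+-congˡ (-‿cong p′-u))
    tail-≈ : ∀ s → expectation (p′ ∘ suc) (f ∘ (s ∷_)) ≈ expectation (p ∘ suc) (f ∘ (s ∷_))
    tail-≈ s = expectation-congˡ (f ∘ (s ∷_)) (λ v → p′≡p (suc v) λ ())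
    insert : ∀ S → f (inside ∷ (S ∪ ⊥)) ≈ f (inside ∷ S)
    insert S = reflexive (≡.cong (λ T → f (inside ∷ T)) (∪-identityʳ S))
    inside-gain : expectation (p ∘ suc) (gain f zero ∘ (inside ∷_)) ≈ 0#
    inside-gain = trans
      (expectation-cong (p ∘ suc) (λ S → trans (+-congʳ (insert S)) (-‿inverseʳ (f (inside ∷ S)))))
      (expectation-const (p ∘ suc) 0#)
    outside-gain : expectation (p ∘ suc) (gain f zero ∘ (outside ∷_)) ≈ F₁ - F₀
    outside-gain = trans
      (expectation-cong (p ∘ suc) (λ S → +-congʳ (insert S)))
      (trans (expectation-+ (p ∘ suc) (f ∘ (inside ∷_)) (λ S → - f (outside ∷ S)))
        (+-congˡ (expectation-neg (p ∘ suc) (f ∘ (outside ∷_)))))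
  expectation-insert {suc n} p p′ f (suc u) e p′≡p p′-u = begin-equality
    expectation p′ f - expectation p f
      ≈⟨ +-cong (expectation-step p′ f) (-‿cong (expectation-step p f)) ⟩
    (p′ zero * F₁′ + (1# - p′ zero) * F₀′) - (p zero * F₁ + q * F₀)
      ≈⟨ +-congʳ (+-cong (*-congʳ p′≈p) (*-congʳ (+-congˡ (-‿cong p′≈p)))) ⟩
    (p zero * F₁′ + q * F₀′) - (p zero * F₁ + q * F₀)
      ≈⟨ solve 6 (λ p q a b c d → (p :* a :+ q :* b) :- (p :* c :+ q :* d) := p :* (a :- c) :+ q :* (b :- d)) refl
           (p zero) q F₁′ F₀′ F₁ F₀ ⟩
    p zero * (F₁′ - F₁) + q * (F₀′ - F₀)
      ≈⟨ +-cong (*-congˡ (tail-insert inside)) (*-congˡ (tail-insert outside)) ⟩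
    p zero * ((1# - e) * G₁) + q * ((1# - e) * G₀)
      ≈⟨ solve 5 (λ p q e a b → p :* (e :* a) :+ q :* (e :* b) := e :* (p :* a :+ q :* b)) refl (p zero) q (1# - e) G₁ G₀ ⟩
    (1# - e) * (p zero * G₁ + q * G₀)
      ≈⟨ *-congˡ (+-cong (*-congˡ (tail-gain inside)) (*-congˡ (tail-gain outside))) ⟨
    (1# - e) * (p zero * expectation (p ∘ suc) (gain f (suc u) ∘ (inside ∷_))
                + q * expectation (p ∘ suc) (gain f (suc u) ∘ (outside ∷_)))
      ≈⟨ *-congˡ (expectation-step p (gain f (suc u))) ⟨
    (1# - e) * expectation p (gain f (suc u)) ∎
    where
    q F₀ F₁ F₀′ F₁′ G₀ G₁ : Carrier
    q   = 1# - p zero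
    F₁  = expectation (p ∘ suc) (f ∘ (inside ∷_))
    F₀  = expectation (p ∘ suc) (f ∘ (outside ∷_))
    F₁′ = expectation (p′ ∘ suc) (f ∘ (inside ∷_))
    F₀′ = expectation (p′ ∘ suc) (f ∘ (outside ∷_))
    G₁  = expectation (p ∘ suc) (gain (f ∘ (inside ∷_)) u)
    G₀  = expectation (p ∘ suc) (gain (f ∘ (outside ∷_)) u)
    p′≈p : p′ zero ≈ p zero
    p′≈p = reflexive (p′≡p zero λ ())
    tail-insert : ∀ s → expectation (p′ ∘ suc) (f ∘ (s ∷_)) - expectation (p ∘ suc) (f ∘ (s ∷_))
      ≈ (1# - e) * expectation (p ∘ suc) (gain (f ∘ (s ∷_)) u)
    tail-insert s = expectation-insert (p ∘ suc) (p′ ∘ suc) (f ∘ (s ∷_)) u e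
      (λ v v≢u → p′≡p (suc v) (v≢u ∘ suc-injective)) p′-u
    tail-gain : ∀ s → expectation (p ∘ suc) (gain f (suc u) ∘ (s ∷_)) ≈ expectation (p ∘ suc) (gain (f ∘ (s ∷_)) u)
    -- The head of `(s ∷ S) ∪ ⁅ suc u ⁆` computes to `s` only once `s` is known.
    tail-gain inside  = refl
    tail-gain outside = refl

  submodular-side : ∀ {n} {f : Subset (suc n) → Carrier} s → Submodular f → Submodular (f ∘ (s ∷_))
  submodular-side inside  sub S T = sub (inside ∷ S) (inside ∷ T)
  submodular-side outside sub S T = sub (outside ∷ S) (outside ∷ T)

  -- By submodularity, elements of `O` added one after another each gain at most what they gain over
  -- `S` alone. With induction on the ground set, only an element of `O` outside `S` calls for
  -- submodularity.
  ∪-≤-gains : ∀ {n} (f : Subset n → Carrier) → Submodular f → ∀ S O →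
    f (S ∪ O) ≤ f S + sumOver O (λ v → gain f v S)
  ∪-≤-gains f sub [] [] = ≤-reflexive (sym (+-identityʳ _))
  ∪-≤-gains f sub (s ∷ S) (o ∷ O) = step s o
    where
    tail-gains : Side → Carrier
    tail-gains s = sumOver O (λ v → gain (f ∘ (s ∷_)) v S)
    IH : ∀ s → f (s ∷ (S ∪ O)) ≤ f (s ∷ S) + tail-gains s
    IH s = ∪-≤-gains (f ∘ (s ∷_)) (submodular-side s sub) S O
    drop : ∀ s → f (s ∷ S) + tail-gains s ≤ f (s ∷ S) + (0# + tail-gains s)
    drop s = ≤-reflexive (+-congˡ (sym (+-identityˡ (tail-gains s))))
    S∪[S∪O]≡S∪O : S ∪ (S ∪ O) ≡ S ∪ O
    S∪[S∪O]≡S∪O = ≡.trans (≡.sym (∪-assoc S S O)) (≡.cong (_∪ O) (∪-idem S))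
    step : ∀ s o → f ((s ∷ S) ∪ (o ∷ O)) ≤ f (s ∷ S) + sumOver (o ∷ O) (λ v → gain f v (s ∷ S))
    -- An element outside `O` contributes 0# to `sumOver`, which `drop` supplies.
    step inside  outside = ≤-trans (IH inside) (drop inside)
    step outside outside = ≤-trans (IH outside) (drop outside)
    step inside  inside  = begin
      f (inside ∷ (S ∪ O))                           ≤⟨ IH inside ⟩
      f (inside ∷ S) + tail-gains inside
        ≈⟨ +-congˡ (+-identityˡ _) ⟨
      f (inside ∷ S) + (0# + tail-gains inside)
        ≈⟨ +-congˡ (+-congʳ (trans (+-congʳ (reflexive (≡.cong (λ T → f (inside ∷ T)) (∪-identityʳ S)))) (-‿inverseʳ _))) ⟨
      f (inside ∷ S) + (gain f zero (inside ∷ S) + tail-gains inside) ∎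
    step outside inside  = begin
      f (inside ∷ (S ∪ O))
        ≈⟨ solve 2 (λ a b → a := (a :+ b) :- b) refl (f (inside ∷ (S ∪ O))) (f (outside ∷ S)) ⟩
      f (inside ∷ (S ∪ O)) + f (outside ∷ S) - f (outside ∷ S)
        ≤⟨ +-monoˡ-≤ _ submodularity ⟩
      f (inside ∷ (S ∪ ⊥)) + f (outside ∷ (S ∪ O)) - f (outside ∷ S)
        ≤⟨ +-monoˡ-≤ _ (+-monoʳ-≤ _ (IH outside)) ⟩
      f (inside ∷ (S ∪ ⊥)) + (f (outside ∷ S) + tail-gains outside) - f (outside ∷ S)
        ≈⟨ solve 3 (λ a b g → a :+ (b :+ g) :- b := b :+ ((a :- b) :+ g)) refl
             (f (inside ∷ (S ∪ ⊥))) (f (outside ∷ S)) (tail-gains outside) ⟩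
      f (outside ∷ S) + (gain f zero (outside ∷ S) + tail-gains outside) ∎
      where
      submodularity : f (inside ∷ (S ∪ O)) + f (outside ∷ S) ≤ f (inside ∷ (S ∪ ⊥)) + f (outside ∷ (S ∪ O))
      submodularity = begin
        f (inside ∷ (S ∪ O)) + f (outside ∷ S)
          ≈⟨ +-cong (reflexive (≡.cong (λ T → f (inside ∷ T)) S∪[S∪O]≡S∪O))
                    (reflexive (≡.cong (λ T → f (outside ∷ T)) (∩-abs-∪ S O))) ⟨
        f (inside ∷ (S ∪ (S ∪ O))) + f (outside ∷ (S ∩ (S ∪ O)))
          -- The two sets differ at element zero, and one tail contains the other. Their union is
          -- `inside ∷ (S ∪ O)` and their intersection `outside ∷ S`, by idempotence and absorption
          -- in the tails.
          ≤⟨ sub (inside ∷ S) (outside ∷ (S ∪ O)) ⟩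
        f (inside ∷ S) + f (outside ∷ (S ∪ O))
          ≈⟨ +-congʳ (reflexive (≡.cong (λ T → f (inside ∷ T)) (∪-identityʳ S))) ⟨
        f (inside ∷ (S ∪ ⊥)) + f (outside ∷ (S ∪ O)) ∎

-- The extension, its marginals, and the inequality in expectation.

module Marginals {c ℓ₁ ℓ₂} (ℛ : Reals c ℓ₁ ℓ₂)
  (exp : Reals.Carrier ℛ → Reals.Carrier ℛ)
  (exp-converges : ∀ x → Reals.ConvergesTo ℛ (Exponential.expSum ℛ x) (exp x)) where
  open Reals ℛ
  open OrderedField ℛ
  open SetFunctions ℛ using (Monotone; Submodular; sumOver; increase; RightLimitAt0)
  open NullSequences ℛ
  open ExponentialProperties ℛ exp exp-converges
  open Expectation ℛ
  open ≤-Reasoning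
  open IntegerSolver commutativeRing

  -- Restated over the abstract `exp`; at `Exponential.exp` this and `extension` unfold to the same
  -- terms as in `SetFunctions`, so results transfer as they stand.
  inclusionProb : ∀ {n} → Vector Carrier n → Vector Carrier n
  inclusionProb A u = 1# - exp (- A u)

  extension : ∀ {n} → (Subset n → Carrier) → Vector Carrier n → Carrier
  extension f A = expectation (inclusionProb A) f

  1-[1-x]≈x : ∀ x → 1# - (1# - x) ≈ x
  1-[1-x]≈x x = solve 1 (λ x → con (1 , 0) :- (con (1 , 0) :- x) := x) refl x

  inclusionProb-nonneg : ∀ {n} (A : Vector Carrier n) → (∀ u → 0# ≤ A u) → ∀ u → 0# ≤ inclusionProb A u
  inclusionProb-nonneg A 0≤A u = x≤y⇒0≤y-x (exp-neg≤1 (0≤A u))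

  inclusionProb≤1 : ∀ {n} (A : Vector Carrier n) → (∀ u → 0# ≤ A u) → ∀ u → inclusionProb A u ≤ 1#
  inclusionProb≤1 A 0≤A u = 0≤y-x⇒x≤y (≤-trans (exp-neg-nonneg (0≤A u)) (≤-reflexive (sym (1-[1-x]≈x (exp (- A u))))))

  -- The probability of missing `u` is exp(-A u), and the functional equation splits off the factor
  -- exp(-t). This is the hypothesis under which `expectation-insert` applies.
  inclusionProb-increase : ∀ {n} (A : Vector Carrier n) u t →
    1# - inclusionProb (increase A u t) u ≈ (1# - inclusionProb A u) * exp (- t)
  inclusionProb-increase A u t = begin-equality
    1# - inclusionProb (increase A u t) u      ≈⟨ 1-[1-x]≈x (exp (- increase A u t u)) ⟩
    exp (- increase A u t u)
      ≈⟨ exp-cong (trans (-‿cong (reflexive (updateAt-updates u A))) (sym (-‿+-comm (A u) t))) ⟩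
    exp (- A u + - t)                          ≈⟨ exp-+ (- A u) (- t) ⟩
    exp (- A u) * exp (- t)                    ≈⟨ *-congʳ (1-[1-x]≈x (exp (- A u))) ⟨
    (1# - inclusionProb A u) * exp (- t)       ∎

  extension-increase : ∀ {n} (f : Subset n → Carrier) A u t →
    extension f (increase A u t) - extension f A ≈ (1# - exp (- t)) * extension (gain f u) A
  extension-increase f A u t =
    expectation-insert (inclusionProb A) (inclusionProb (increase A u t)) f u (exp (- t))
      (λ v v≢u → ≡.cong (λ x → 1# - exp (- x)) (updateAt-minimal v u A v≢u))
      (inclusionProb-increase A u t)

  -- The difference quotient misses the expected gain `D` by ((1 - e⁻ᵗ)/t - 1) D, which is at most t
  -- k in magnitude for a natural number k above |D|.
  extension-gain-isMarginal : ∀ {n} (f : Subset n → Carrier) A u → RightLimitAt0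
    (λ t 0<t → (extension f (increase A u t) - extension f A) * recip t 0<t) (extension (gain f u) A)
  extension-gain-isMarginal f A u = RightLimitAt0-linear (fromℕ-nonneg (proj₁ D≤k)) λ t 0<t t<1 →
    BoundedBy-resp (quotient t 0<t) ≤-refl (BoundedBy-* ([1-exp-neg]/t 0<t t<1) (proj₂ D≤k))
    where
    D : Carrier
    D = extension (gain f u) A
    D≤k : ∃[ k ] D BoundedBy fromℕ k
    D≤k = archimedean-bound D
    quotient : ∀ t (0<t : 0# < t) → ((1# - exp (- t)) * recip t 0<t - 1#) * D
      ≈ (extension f (increase A u t) - extension f A) * recip t 0<t - D
    quotient t 0<t = trans
      (solve 3 (λ p r D → (p :* r :- con (1 , 0)) :* D := p :* D :* r :- D) refl (1# - exp (- t)) (recip t 0<t) D)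
      (+-congʳ (*-congʳ (sym (extension-increase f A u t))))

  value≤extension+gains : ∀ {n} (f : Subset n → Carrier) → Monotone f → Submodular f →
    ∀ O (A : Vector Carrier n) → (∀ u → 0# ≤ A u) →
    f O ≤ extension f A + sumOver O (λ v → extension (gain f v) A)
  value≤extension+gains f monotone submodular O A 0≤A = begin
    f O                                                            ≈⟨ expectation-const (inclusionProb A) (f O) ⟨
    extension (λ _ → f O) A
      ≤⟨ expectation-mono (inclusionProb A) (inclusionProb-nonneg A 0≤A) (inclusionProb≤1 A 0≤A)
           (λ S → ≤-trans (monotone O (S ∪ O) (q⊆p∪q S O)) (∪-≤-gains f submodular S O)) ⟩
    extension (λ S → f S + sumOver O (λ v → gain f v S)) A
      ≈⟨ expectation-+ (inclusionProb A) f (λ S → sumOver O (λ v → gain f v S)) ⟩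
    extension f A + extension (λ S → sumOver O (λ v → gain f v S)) A
      ≈⟨ +-congˡ (expectation-sumOver (inclusionProb A) O (gain f)) ⟩
    extension f A + sumOver O (λ v → extension (gain f v) A)       ∎

lemma4p5 : ∀ {c ℓ₁ ℓ₂} (ℛ : Reals c ℓ₁ ℓ₂) →
    let open Reals ℛ
        open SetFunctions ℛ
    in (n : ℕ) (f : Subset n → Carrier) →
       Nonnegative f → Monotone f → Submodular f →
       (O : Subset n) (A : Vector Carrier n) → (∀ u → 0# ≤ A u) →
       Σ (Vector Carrier n) λ marginal →
         (∀ u → IsMarginal f A u (marginal u)) ×
         (f O ≤ extension f A + sumOver O marginal)
lemma4p5 ℛ n f _ monotone submodular O A 0≤A =
  (λ u → SetFunctions.extension ℛ (Expectation.gain ℛ f u) A) ,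
  Marginals.extension-gain-isMarginal ℛ (Exponential.exp ℛ) (Exponential.exp-converges ℛ) f A ,
  Marginals.value≤extension+gains ℛ (Exponential.exp ℛ) (Exponential.exp-converges ℛ) f monotone submodular O A 0≤A
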